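{- For all integers $n\geq 0$ and all integers $k$ with $0\leq k\leq 9$, the polynomial $\mathrm{Cat}_{n,k}(q,t)$ is jointly symmetric: $\mathrm{Cat}_{n,k}(q,t)=\mathrm{Cat}_{n,k}(t,q)$.
   Context: A Dyck vector of length $n$ is a sequence $v=(v_1,\ldots,v_n)$ of integers with $v_1=0$, all $v_i\geq 0$, and $v_{i+1}\leq v_i+1$ for all $i<n$; let $\mathrm{DV}_n$ be the set of these. Define $\mathrm{area}(v)=v_1+\cdots+v_n$, $\mathrm{dinv}(v)$ = the number of pairs $i<j$ with $v_i-v_j\in\{0,1\}$, and the deficit $\mathrm{def}(v)=\binom{n}{2}-\mathrm{area}(v)-\mathrm{dinv}(v)$. For $n,k\geq 0$ set $\mathrm{Cat}_{n,k}(q,t)=\sum_{v\in\mathrm{DV}_n,\ \mathrm{def}(v)=k} q^{\mathrm{area}(v)}t^{\mathrm{dinv}(v)}$. -}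

module Defs where

open import Data.Nat using (ℕ; zero; suc; _+_; _*_; _≤_; _≟_; _≤?_; _∸_)
open import Data.Nat.Combinatorics using (_C_)
open import Data.List using (List; []; _∷_; map; concatMap; filterᵇ; length; upTo)
open import Data.Nat.ListAction using (sum)
open import Data.List.Relation.Unary.All using (All)
open import Data.Product using (_×_; _,_)
open import Data.Bool using (Bool; true; false; _∧_; _∨_)
open import Relation.Nullary.Decidable using (⌊_⌋; Dec; yes; no)
open import Relation.Binary.PropositionalEquality using (_≡_)

stepOK : List ℕ → Bool
stepOK [] = true
stepOK (x ∷ []) = true
stepOK (x ∷ y ∷ xs) = ⌊ y ≤? suc x ⌋ ∧ stepOK (y ∷ xs)

isDyck : List ℕ → Bool
isDyck [] = true
isDyck (x ∷ xs) = ⌊ x ≟ 0 ⌋ ∧ stepOK (x ∷ xs)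

allVecs : ℕ → ℕ → List (List ℕ)
allVecs m zero = [] ∷ []
allVecs m (suc n) = concatMap (λ x → map (x ∷_) (allVecs m n)) (upTo m)

-- DV_n : all Dyck vectors of length n. Every Dyck vector of length n has
-- v_i ≤ i-1 < n, so it is among the vectors with entries in {0,…,n-1}.
DV : ℕ → List (List ℕ)
DV n = filterᵇ isDyck (allVecs n n)

area : List ℕ → ℕ
area = sum

diffIn01 : ℕ → ℕ → Bool
diffIn01 a b = ⌊ a ≟ b ⌋ ∨ ⌊ a ≟ suc b ⌋

dinv : List ℕ → ℕ
dinv [] = 0
dinv (x ∷ xs) = length (filterᵇ (diffIn01 x) xs) + dinv xs

-- def(v) = k  ⇔  binom(n,2) = area(v) + dinv(v) + k  (n = length v);
-- stated additively so that no truncated subtraction is involved.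
hasDef : ℕ → List ℕ → Bool
hasDef k v = ⌊ length v C 2 ≟ area v + dinv v + k ⌋

-- Coefficient of q^a t^b in Cat_{n,k}(q,t):
-- #{ v ∈ DV_n : def(v) = k, area(v) = a, dinv(v) = b }
catCoeff : ℕ → ℕ → ℕ → ℕ → ℕ
catCoeff n k a b =
  length (filterᵇ (λ v → hasDef k v ∧ ⌊ area v ≟ a ⌋ ∧ ⌊ dinv v ≟ b ⌋) (DV n))

open import Relation.Binary.PropositionalEquality using (refl)
private
  t1 : length (DV 4) ≡ 14
  t1 = refl
  t2 : catCoeff 4 0 1 5 ≡ 1
  t2 = refl

{-# OPTIONS --safe #-}
module Submission where

-- Deleting the zeros of a Dyck vector v and lowering all other entries by one gives a shorter Dyck
-- vector w, and v is recovered from w and the word σ formed by the entries 0 and 1 of v after its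
-- first zero.  If v has y + 1 zeros and m nonzero entries, r of which are at least 2, then
--   area v = area w + m   and   def v = def w + inv σ + y r,
-- where inv counts the pairs of a 0 before a 1.  This recursion computes the number N(n,a) of Dyck
-- vectors of length n, deficit k and area a.  Since area and dinv add up to D = n(n-1)/2 - k, the
-- claim is N(n,a) = N(n,D-a).  As every nonzero y r is bounded by k, for n ≥ 2k + 4 one gets
--   N(n+1,a)   = N(n,a)    if a ≤ n - k - 2          (append a 0),
--   N(n+1,a+1) = N(n,a)    if n - k - 2 ≤ a < n + k - 1  (insert a 1),
--   N(n+1,a+n) = N(n,a)    if a ≥ k                  (prepend a 0 to v + 1).
-- Hence symmetry in a, together with constancy of N(n,-) on [k, D-k], propagates from n = 2k + 4 to
-- all larger n.  For k ≤ 9 the cases n ≤ 2k + 4 are evaluated.  Below, p stands for n - 1.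

open import Defs
open import Data.Bool using (Bool; true; false; if_then_else_; _∧_; _∨_; T; T?)
open import Data.Bool.Properties using (T-∧)
open import Data.List using (List; []; _∷_; [_]; _++_; concat; concatMap; filterᵇ; foldr; length; map; replicate; upTo)
open import Data.List.Membership.Propositional using (_∈_; find; lose)
open import Data.List.Membership.Propositional.Properties
  using (∈-concatMap⁺; ∈-concatMap⁻; ∈-map⁺; ∈-map⁻; ∈-++⁻; ∈-++⁺ˡ; ∈-++⁺ʳ; ∈-filter⁺; ∈-filter⁻; ∈-upTo⁺)
open import Data.List.Membership.Propositional.Properties.WithK using (unique∧set⇒bag)
open import Data.List.Properties
  using (map-cong-local; map-∘; map-++; map-id; map-concatMap; concatMap-map; concatMap-++; concatMap-cong; concatMap-pure; ++-identityʳ)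
open import Data.List.Relation.Binary.BagAndSetEquality using (∼bag⇒↭)
open import Data.List.Relation.Binary.Permutation.Propositional.Properties using (↭-length)
open import Data.List.Relation.Unary.All as All using (All; []; _∷_)
open import Data.List.Relation.Unary.Any using (here; there)
open import Data.List.Relation.Unary.Unique.Propositional using (Unique; []; _∷_)
import Data.List.Relation.Unary.Unique.Propositional.Properties as Unique
open import Data.Nat
open import Data.Nat.Combinatorics using (_C_; nC1≡n; nCk+nC[k+1]≡[n+1]C[k+1])
open import Data.Nat.Properties
open import Data.Nat.Tactic.RingSolver using (solve-∀)
open import Data.Product using (_×_; _,_; ∃-syntax; proj₁; proj₂)
open import Data.Sum using (inj₁; inj₂)
open import Function using (_∘_; Equivalence; mk⇔)
open import Relation.Binary.PropositionalEquality hiding ([_])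
open import Relation.Nullary using (¬_; yes; no; contradiction)
open import Relation.Nullary.Decidable using (⌊_⌋; isYes≗does; toWitness; fromWitness)

private variable
  X Y : Set

-- Concatenated lists

concatMap-∈⁺ : (f : X → List Y) {xs : List X} {x : X} {v : Y} → x ∈ xs → v ∈ f x → v ∈ concatMap f xs
concatMap-∈⁺ f x∈xs v∈fx = ∈-concatMap⁺ f (lose x∈xs v∈fx)

concatMap-∈⁻ : (f : X → List Y) {xs : List X} {v : Y} → v ∈ concatMap f xs → ∃[ x ] x ∈ xs × v ∈ f x
concatMap-∈⁻ f v∈ = find (∈-concatMap⁻ f v∈)

concatMap-cong-∈ : {f g : X → List Y} (xs : List X) → (∀ {x} → x ∈ xs → f x ≡ g x) → concatMap f xs ≡ concatMap g xs
concatMap-cong-∈ xs f≡g = cong concat (map-cong-local (All.tabulate f≡g))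

concatMap-[] : {f : X → List Y} (xs : List X) → (∀ {x} → x ∈ xs → f x ≡ []) → concatMap f xs ≡ []
concatMap-[] []       f≡[] = refl
concatMap-[] (x ∷ xs) f≡[] = cong₂ _++_ (f≡[] (here refl)) (concatMap-[] xs (f≡[] ∘ there))

-- Counting occurrences

cnt : ℕ → List ℕ → ℕ
cnt a []       = 0
cnt a (x ∷ xs) = (if x ≡ᵇ a then 1 else 0) + cnt a xs

cnt-++ : ∀ a xs ys → cnt a (xs ++ ys) ≡ cnt a xs + cnt a ys
cnt-++ a []       ys = refl
cnt-++ a (x ∷ xs) ys = trans (cong ((if x ≡ᵇ a then 1 else 0) +_) (cnt-++ a xs ys)) (sym (+-assoc (if x ≡ᵇ a then 1 else 0) _ _))

-- Two values `a` and `b` are allowed because the stability proofs compare counts at areas that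
-- differ by one.
cnt-concatMap-cong : ∀ {a b} {f g : X → List ℕ} (xs : List X) →
  (∀ {x} → x ∈ xs → cnt a (f x) ≡ cnt b (g x)) → cnt a (concatMap f xs) ≡ cnt b (concatMap g xs)
cnt-concatMap-cong [] eq = refl
cnt-concatMap-cong {a = a} {b} {f} {g} (x ∷ xs) eq =
  trans (cnt-++ a (f x) _) (trans (cong₂ _+_ (eq (here refl)) (cnt-concatMap-cong xs (eq ∘ there))) (sym (cnt-++ b (g x) _)))

cnt-map-+ : ∀ m a xs → cnt (m + a) (map (m +_) xs) ≡ cnt a xs
cnt-map-+ m a []       = refl
cnt-map-+ m a (x ∷ xs) = cong₂ _+_ (cong (if_then 1 else 0) (≡ᵇ-+ m)) (cnt-map-+ m a xs)
  where
  ≡ᵇ-+ : ∀ m → (m + x ≡ᵇ m + a) ≡ (x ≡ᵇ a)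
  ≡ᵇ-+ zero    = refl
  ≡ᵇ-+ (suc m) = ≡ᵇ-+ m

cnt-∉ : ∀ a xs → (∀ {x} → x ∈ xs → x ≢ a) → cnt a xs ≡ 0
cnt-∉ a []       x≢a = refl
cnt-∉ a (x ∷ xs) x≢a with x ≡ᵇ a in eq
... | false = cnt-∉ a xs (x≢a ∘ there)
... | true  = contradiction (≡ᵇ⇒≡ x a (subst T (sym eq) _)) (x≢a (here refl))

-- Areas of Dyck vectors of given deficit

diag : ℕ → List (ℕ × ℕ)
diag zero    = (0 , 0) ∷ []
diag (suc p) = (0 , suc p) ∷ map (λ (y , m) → suc y , m) (diag p)

∈-diag⁺ : ∀ y m → (y , m) ∈ diag (y + m)
∈-diag⁺ zero    zero    = here refl
∈-diag⁺ zero    (suc m) = here refl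
∈-diag⁺ (suc y) m       = there (∈-map⁺ _ (∈-diag⁺ y m))

∈-diag⁻ : ∀ p {y m} → (y , m) ∈ diag p → y + m ≡ p
∈-diag⁻ zero    (here refl) = refl
∈-diag⁻ (suc p) (here refl) = refl
∈-diag⁻ (suc p) (there ym∈) with ∈-map⁻ _ ym∈
... | _ , ym∈′ , refl = cong suc (∈-diag⁻ p ym∈′)

-- The definition of `diag` splits off the pair with first component 0, which suits adding a zero
-- entry to a vector. This form splits off the pair with second component 0, which suits adding a
-- nonzero entry.
diag-∷ʳ : ∀ p → diag (suc p) ≡ map (λ (y , m) → y , suc m) (diag p) ++ [ suc p , 0 ]
diag-∷ʳ zero    = refl
diag-∷ʳ (suc p) = cong ((0 , suc (suc p)) ∷_) (begin
  map (λ (y , m) → suc y , m) (diag (suc p))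
    ≡⟨ cong (map _) (diag-∷ʳ p) ⟩
  map (λ (y , m) → suc y , m) (map (λ (y , m) → y , suc m) (diag p) ++ [ suc p , 0 ])
    ≡⟨ map-++ _ (map _ (diag p)) _ ⟩
  map (λ (y , m) → suc y , m) (map (λ (y , m) → y , suc m) (diag p)) ++ [ suc (suc p) , 0 ]
    ≡⟨ cong (_++ [ suc (suc p) , 0 ]) (trans (sym (map-∘ (diag p))) (map-∘ (diag p))) ⟩
  map (λ (y , m) → y , suc m) (map (λ (y , m) → suc y , m) (diag p)) ++ [ suc (suc p) , 0 ] ∎)
  where open ≡-Reasoning

-- The difference k − c as a list with at most one element, empty when c > k.
sub : ℕ → ℕ → List ℕ
sub zero    k       = k ∷ []
sub (suc c) zero    = []
sub (suc c) (suc k) = sub c k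

∈-sub⁺ : ∀ c k → k ∈ sub c (c + k)
∈-sub⁺ zero    k = here refl
∈-sub⁺ (suc c) k = ∈-sub⁺ c k

∈-sub⁻ : ∀ c k {k′} → k′ ∈ sub c k → c + k′ ≡ k
∈-sub⁻ zero    k       (here refl) = refl
∈-sub⁻ (suc c) (suc k) k′∈         = cong suc (∈-sub⁻ c k k′∈)

sub-[] : ∀ {c k} → k < c → sub c k ≡ []
sub-[] {suc c} {zero}  _         = refl
sub-[] {suc c} {suc k} (s≤s k<c) = sub-[] k<c

-- The numbers k − inv σ, for the words σ with j ones and y zeros such that inv σ ≤ k.
remainders : ℕ → ℕ → ℕ → List ℕ
remainders zero    y       k = k ∷ []
remainders (suc j) zero    k = k ∷ []
remainders (suc j) (suc y) k = remainders j (suc y) k ++ concatMap (remainders (suc j) y) (sub (suc j) k)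

∈-remainders⇒≤ : ∀ j y {k k′} → k′ ∈ remainders j y k → k′ ≤ k
∈-remainders⇒≤ zero    y       (here refl) = ≤-refl
∈-remainders⇒≤ (suc j) zero    (here refl) = ≤-refl
∈-remainders⇒≤ (suc j) (suc y) {k} k′∈ with ∈-++⁻ (remainders j (suc y) k) k′∈
... | inj₁ p = ∈-remainders⇒≤ j (suc y) p
... | inj₂ p with concatMap-∈⁻ (remainders (suc j) y) p
...   | c , c∈ , q = ≤-trans (∈-remainders⇒≤ (suc j) y q) (m+n≤o⇒n≤o (suc j) (≤-reflexive (∈-sub⁻ (suc j) k c∈)))

-- A 0 in front of `suc j` ones makes more than `k` inversions, so a word with an extra one must
-- start with 1, and that 1 adds no inversion.
remainders-stableˡ : ∀ j y {k} → k ≤ j → remainders (suc j) y k ≡ remainders j y k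
remainders-stableˡ zero    zero    k≤j = refl
remainders-stableˡ (suc j) zero    k≤j = refl
remainders-stableˡ j       (suc y) {k} k≤j rewrite sub-[] (s≤s k≤j) = ++-identityʳ (remainders j (suc y) k)

-- A final 1 behind `suc y` zeros makes more than `k` inversions, so a word with an extra zero must
-- end in 0, and that 0 adds no inversion. The induction still runs from the first letter, as
-- `remainders` does.
remainders-stableʳ : ∀ j y {k} → k ≤ y → remainders j (suc y) k ≡ remainders j y k
remainders-stableʳ zero    y       k≤y = refl
remainders-stableʳ (suc j) zero    z≤n = trans (++-identityʳ (remainders j 1 0)) (trans (remainders-stableʳ j 0 z≤n) (remainders-zero j))
  where
  remainders-zero : ∀ j {k} → remainders j 0 k ≡ k ∷ []
  remainders-zero zero    = refl
  remainders-zero (suc j) = refl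
remainders-stableʳ (suc j) (suc y) {k} k≤y = cong₂ _++_ (remainders-stableʳ j (suc y) k≤y)
  -- After a leading 0 the rest `c` satisfies `suc j + c ≡ k ≤ suc y`, hence `c ≤ y`.
  (concatMap-cong-∈ (sub (suc j) k) λ {c} c∈ →
    remainders-stableʳ (suc j) y (≤-pred (≤-trans (s≤s (m≤n+m c j)) (≤-trans (≤-reflexive (∈-sub⁻ (suc j) k c∈)) k≤y))))

zeroVectorArea : ℕ → List ℕ
zeroVectorArea zero    = 0 ∷ []
zeroVectorArea (suc k) = []

-- The areas of the Dyck vectors with y + 1 zeros, m nonzero entries and deficit k.  The first
-- argument f is fuel; the list is complete when m ≤ f.
areasWith : ℕ → ℕ → ℕ → ℕ → List ℕ
-- The vectors v whose lowered vector w has `suc j` zeros and `r` nonzero entries, where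
-- `j + r ≡ m`. Here `k′` is the deficit left for w after subtracting `y * r` and the inversions of
-- the word.
areaBlock : ℕ → ℕ → ℕ → ℕ → ℕ → ℕ → List ℕ

areasWith f       y zero    k = zeroVectorArea k
areasWith zero    y (suc m) k = []
areasWith (suc f) y (suc m) k = concatMap (λ (j , r) → areaBlock f y m k j r) (diag m)

areaBlock f y m k j r = concatMap (λ k′ → map (suc m +_) (areasWith f j r k′)) (concatMap (remainders (suc j) y) (sub (y * r) k))

∈-zeroVectorArea⁻ : ∀ k {x} → x ∈ zeroVectorArea k → x ≡ 0
∈-zeroVectorArea⁻ zero (here refl) = refl

∈-remainders-sub⁻ : ∀ j y c {k k′} → k′ ∈ concatMap (remainders j y) (sub c k) → c + k′ ≤ k
∈-remainders-sub⁻ j y c {k} k′∈ with concatMap-∈⁻ (remainders j y) k′∈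
... | d , d∈ , q = ≤-trans (+-monoʳ-≤ c (∈-remainders⇒≤ j y q)) (≤-reflexive (∈-sub⁻ c k d∈))

record AreaBlock (f y m k j r x : ℕ) : Set where
  field
    k′ x′  : ℕ
    bound  : y * r + k′ ≤ k
    x′∈    : x′ ∈ areasWith f j r k′
    shift  : x ≡ suc m + x′

∈-areaBlock⁻ : ∀ f y m k j r {x} → x ∈ areaBlock f y m k j r → AreaBlock f y m k j r x
∈-areaBlock⁻ f y m k j r x∈ with concatMap-∈⁻ (λ k′ → map (suc m +_) (areasWith f j r k′)) x∈
... | k′ , k′∈ , p with ∈-map⁻ _ p
...   | x′ , x′∈ , eq = record { k′ = k′ ; x′ = x′ ; bound = ∈-remainders-sub⁻ (suc j) y (y * r) k′∈ ; x′∈ = x′∈ ; shift = eq }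

areaBlock-[] : ∀ f y m k j r → k < y * r → areaBlock f y m k j r ≡ []
areaBlock-[] f y m k j r k<yr rewrite sub-[] k<yr = refl

∈-areasWith⇒≤ : ∀ f y m k {x} → x ∈ areasWith f y m k → m ≤ x
∈-areasWith⇒≤ f       y zero    k _  = z≤n
∈-areasWith⇒≤ (suc f) y (suc m) k x∈ with concatMap-∈⁻ (λ (j , r) → areaBlock f y m k j r) {diag m} x∈
... | (j , r) , _ , p with ∈-areaBlock⁻ f y m k j r p
...   | record { x′ = x′ ; shift = refl } = s≤s (m≤m+n m x′)

concatMap-diag-last : ∀ m {F : ℕ → ℕ → List X} → (∀ j r → F j (suc r) ≡ []) →
  concatMap (λ (j , r) → F j r) (diag m) ≡ F m 0
concatMap-diag-last zero        F≡[] = ++-identityʳ _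
concatMap-diag-last (suc m) {F} F≡[] = begin
  F 0 (suc m) ++ concatMap (λ (j , r) → F j r) (map (λ (y , m) → suc y , m) (diag m))
    ≡⟨ cong₂ _++_ (F≡[] 0 m) (concatMap-map _ _ (diag m)) ⟩
  concatMap (λ (j , r) → F (suc j) r) (diag m)
    ≡⟨ concatMap-diag-last m (λ j → F≡[] (suc j)) ⟩
  F (suc m) 0 ∎
  where open ≡-Reasoning

-- If y > k then y r ≤ k forces r = 0, so that all entries are 0 or 1.
areasWith-wide : ∀ f y m {k} → k < y → m ≤ f → areasWith f y m k ≡ map (m +_) (concatMap zeroVectorArea (remainders m y k))
areasWith-wide f       y zero    {k} k<y _ = sym (trans (map-id _) (++-identityʳ (zeroVectorArea k)))
areasWith-wide (suc f) y (suc m) {k} k<y _ = begin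
  concatMap (λ (j , r) → areaBlock f y m k j r) (diag m)
    ≡⟨ concatMap-diag-last m (λ j r → areaBlock-[] f y m k j (suc r) (≤-trans k<y (m≤m*n y (suc r)))) ⟩
  concatMap (λ k′ → map (suc m +_) (zeroVectorArea k′)) (concatMap (remainders (suc m) y) (sub (y * 0) k))
    ≡⟨ cong (λ c → concatMap (λ k′ → map (suc m +_) (zeroVectorArea k′)) (concatMap (remainders (suc m) y) (sub c k))) (*-zeroʳ y) ⟩
  concatMap (λ k′ → map (suc m +_) (zeroVectorArea k′)) (remainders (suc m) y k ++ [])
    ≡⟨ cong (concatMap _) (++-identityʳ (remainders (suc m) y k)) ⟩
  concatMap (λ k′ → map (suc m +_) (zeroVectorArea k′)) (remainders (suc m) y k)
    ≡⟨ map-concatMap _ zeroVectorArea (remainders (suc m) y k) ⟨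
  map (suc m +_) (concatMap zeroVectorArea (remainders (suc m) y k)) ∎
  where open ≡-Reasoning

∈-areasWith-wide : ∀ f y m {k x} → k < y → m ≤ f → x ∈ areasWith f y m k → x ≡ m
∈-areasWith-wide f y m {k} k<y m≤f x∈ with ∈-map⁻ _ (subst (_ ∈_) (areasWith-wide f y m k<y m≤f) x∈)
... | x′ , p , refl with concatMap-∈⁻ zeroVectorArea {remainders m y k} p
...   | k′ , _ , q = trans (cong (m +_) (∈-zeroVectorArea⁻ k′ q)) (+-identityʳ m)

-- All entries are 0 or 1, so only the word matters, and it gains a final 0.
areasWith-stableʸ : ∀ f f′ y m {k} → k < y → m ≤ f → m ≤ f′ → areasWith f′ (suc y) m k ≡ areasWith f y m k
areasWith-stableʸ f f′ y m {k} k<y m≤f m≤f′ = begin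
  areasWith f′ (suc y) m k                              ≡⟨ areasWith-wide f′ (suc y) m (m<n⇒m<1+n k<y) m≤f′ ⟩
  map (m +_) (concatMap zeroVectorArea (remainders m (suc y) k))   ≡⟨ cong (map (m +_) ∘ concatMap zeroVectorArea) (remainders-stableʳ m y (<⇒≤ k<y)) ⟩
  map (m +_) (concatMap zeroVectorArea (remainders m y k))         ≡⟨ areasWith-wide f y m k<y m≤f ⟨
  areasWith f y m k                                     ∎
  where open ≡-Reasoning

-- The word gains a leading 1, which raises the area by one.
areasWith-stableᵐ : ∀ f y m {k} → k < y → k ≤ m → m ≤ f → areasWith (suc f) y (suc m) k ≡ map suc (areasWith f y m k)
areasWith-stableᵐ f y m {k} k<y k≤m m≤f = begin
  areasWith (suc f) y (suc m) k                               ≡⟨ areasWith-wide (suc f) y (suc m) k<y (s≤s m≤f) ⟩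
  map (suc m +_) (concatMap zeroVectorArea (remainders (suc m) y k))     ≡⟨ cong (map (suc m +_) ∘ concatMap zeroVectorArea) (remainders-stableˡ m y k≤m) ⟩
  map (suc m +_) (concatMap zeroVectorArea (remainders m y k))           ≡⟨ map-∘ _ ⟩
  map suc (map (m +_) (concatMap zeroVectorArea (remainders m y k)))     ≡⟨ cong (map suc) (areasWith-wide f y m k<y m≤f) ⟨
  map suc (areasWith f y m k)                                 ∎
  where open ≡-Reasoning

-- Inserting a 1 has two effects: the word gains a leading 1, and the lowered vector gains a zero.
-- As `k < j`, neither changes the lists beyond the shift of the area by one.
areaBlock-stable : ∀ f y m k j r → k < j → r ≤ f → areaBlock (suc f) y (suc m) k (suc j) r ≡ map suc (areaBlock f y m k j r)
areaBlock-stable f y m k j r k<j r≤f = begin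
  concatMap (λ k′ → map (2 + m +_) (areasWith (suc f) (suc j) r k′)) (concatMap (remainders (2 + j) y) (sub (y * r) k))
    ≡⟨ cong (concatMap _) (concatMap-cong-∈ (sub (y * r) k) λ c∈ → remainders-stableˡ (suc j) y
         (≤-trans (m+n≤o⇒n≤o (y * r) (≤-reflexive (∈-sub⁻ (y * r) k c∈))) (m≤n⇒m≤1+n (<⇒≤ k<j)))) ⟩
  concatMap (λ k′ → map (2 + m +_) (areasWith (suc f) (suc j) r k′)) kept
    ≡⟨ concatMap-cong-∈ kept (λ k′∈ → trans (map-∘ _) (cong (map suc ∘ map (suc m +_))
         (areasWith-stableʸ f (suc f) j r (≤-<-trans (m+n≤o⇒n≤o (y * r) (∈-remainders-sub⁻ (suc j) y (y * r) k′∈)) k<j) r≤f (m≤n⇒m≤1+n r≤f)))) ⟩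
  concatMap (λ k′ → map suc (map (suc m +_) (areasWith f j r k′))) kept
    ≡⟨ map-concatMap suc _ kept ⟨
  map suc (areaBlock f y m k j r) ∎
  where
  open ≡-Reasoning
  kept = concatMap (remainders (suc j) y) (sub (y * r) k)

areas : ℕ → ℕ → List ℕ
areas p k = concatMap (λ (y , m) → areasWith p y m k) (diag p)

-- These vectors have length `p + 2`, one more than those of `areas p k`: `suc y` stands for `y + 2`
-- zeros.
areas≥2zeros : ℕ → ℕ → List ℕ
areas≥2zeros p k = concatMap (λ (y , m) → areasWith (suc p) (suc y) m k) (diag p)

-- If the leading 0 is the only zero, the other `suc p` entries form a Dyck vector raised by one.
-- With `y = 0` neither the product `y * r` nor the word contributes to the deficit.
areas-suc : ∀ p k → areas (suc p) k ≡ map (suc p +_) (areas p k) ++ areas≥2zeros p k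
areas-suc p k = cong₂ _++_ one-zero (concatMap-map _ _ (diag p))
  where
  open ≡-Reasoning
  one-zero : areasWith (suc p) 0 (suc p) k ≡ map (suc p +_) (areas p k)
  one-zero = begin
    concatMap (λ (j , r) → map (suc p +_) (areasWith p j r k) ++ []) (diag p)
      ≡⟨ concatMap-cong (λ (j , r) → ++-identityʳ _) (diag p) ⟩
    concatMap (λ (j , r) → map (suc p +_) (areasWith p j r k)) (diag p)
      ≡⟨ map-concatMap _ _ (diag p) ⟨
    map (suc p +_) (areas p k) ∎

-- Stability in the length

module Step (k p : ℕ) (large : k + k + 3 ≤ p) where

  -- From (y - 1)(r - 1) ≥ 0 follows y r ≥ y + r - 1 ≥ k + 1.
  y*r-large : ∀ {y r} → 1 ≤ y → 1 ≤ r → k + 2 ≤ y + r → k < y * r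
  y*r-large {suc y} {suc r} _ _ h = ≤-trans k<1+y+r 1+y+r≤
    where
    k<1+y+r : suc k ≤ suc (y + r)
    k<1+y+r = ≤-pred (subst₂ _≤_ (+-comm k 2) (cong suc (+-suc y r)) h)
    1+y+r≤ : suc (y + r) ≤ suc y * suc r
    1+y+r≤ = s≤s (subst (_≤ r + y * suc r) (+-comm r y) (+-monoʳ-≤ r (m≤m*n y (suc r))))

  count : ℕ → ℕ → ℕ
  count q a = cnt a (areas q k)

  count-low : ∀ a → a + k + 1 ≤ p → count (suc p) a ≡ count p a
  count-low a small = begin
    count (suc p) a
      ≡⟨ cnt-++ a (areasWith (suc p) 0 (suc p) k) _ ⟩
    cnt a (areasWith (suc p) 0 (suc p) k) + cnt a (concatMap (λ (y , m) → areasWith (suc p) y m k) (map (λ (y , m) → suc y , m) (diag p)))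
      -- A vector with a single zero has area at least `suc p`, hence more than `a`.
      ≡⟨ cong₂ _+_ (cnt-∉ a _ λ x∈ → >⇒≢ (<-≤-trans (s≤s a≤p) (∈-areasWith⇒≤ (suc p) 0 (suc p) k x∈)))
                   (cong (cnt a) (concatMap-map _ _ (diag p))) ⟩
    cnt a (areas≥2zeros p k)
      ≡⟨ cnt-concatMap-cong (diag p) (λ {(y , m)} ym∈ → term y m (∈-diag⁻ p ym∈)) ⟩
    count p a ∎
    where
    open ≡-Reasoning
    a≤p : a ≤ p
    a≤p = ≤-trans (≤-trans (m≤m+n a k) (m≤m+n (a + k) 1)) small
    term : ∀ y m → y + m ≡ p → cnt a (areasWith (suc p) (suc y) m k) ≡ cnt a (areasWith p y m k)
    term y m y+m≡p with k <? y
    ... | yes k<y = cong (cnt a) (areasWith-stableʸ p (suc p) y m k<y m≤p (m≤n⇒m≤1+n m≤p))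
      where m≤p = m+n≤o⇒n≤o y (≤-reflexive y+m≡p)
    -- Here `y ≤ k` forces `a < m`, and no area on either side is below `m`, so both counts are 0.
    ... | no k≮y = trans (cnt-∉ a _ λ x∈ → >⇒≢ (<-≤-trans a<m (∈-areasWith⇒≤ (suc p) (suc y) m k x∈)))
                    (sym (cnt-∉ a _ λ x∈ → >⇒≢ (<-≤-trans a<m (∈-areasWith⇒≤ p y m k x∈))))
      where
      a<m : a < m
      a<m = +-cancelˡ-≤ y (suc a) m (≤-trans (+-monoˡ-≤ (suc a) (≮⇒≥ k≮y))
              (≤-trans (≤-reflexive (trans (+-suc k a) (trans (cong suc (+-comm k a)) (+-comm 1 (a + k)))))
                (≤-trans small (≤-reflexive (sym y+m≡p)))))

  -- The area is `suc m + x′` with `suc m ≤ p`, and the lowered vector has area `x′ ≡ r ≤ k`. For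
  -- `r > 0` this is because `k < j` leaves it only entries 0 and 1, while `j ≤ k` would make
  -- `suc y + r` so large that `suc y * r > k`.
  areas≥2zeros-bounded : ∀ {x} → x ∈ areas≥2zeros p k → x < suc p + k
  areas≥2zeros-bounded {x} x∈ with concatMap-∈⁻ (λ (y , m) → areasWith (suc p) (suc y) m k) {diag p} x∈
  ... | (y , zero) , _ , q rewrite ∈-zeroVectorArea⁻ k q = s≤s z≤n
  ... | (y , suc m) , ym∈ , q with concatMap-∈⁻ (λ (j , r) → areaBlock p (suc y) m k j r) {diag m} q
  ...   | (j , r) , jr∈ , q′ with ∈-areaBlock⁻ p (suc y) m k j r q′
  ...     | record { k′ = k′ ; x′ = x′ ; bound = bound ; x′∈ = x′∈ ; shift = refl } =
    s≤s (begin
      suc m + x′        ≡⟨ cong (suc m +_) (x′≡r r refl) ⟩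
      suc m + r         ≤⟨ +-mono-≤ (m+n≤o⇒n≤o y (≤-reflexive y+m≡p)) r≤k ⟩
      p + k             ∎)
    where
    open ≤-Reasoning
    y+m≡p : y + suc m ≡ p
    y+m≡p = ∈-diag⁻ p ym∈
    j+r≡m : j + r ≡ m
    j+r≡m = ∈-diag⁻ m jr∈
    yr≤k : suc y * r ≤ k
    yr≤k = m+n≤o⇒m≤o (suc y * r) bound
    k′≤k : k′ ≤ k
    k′≤k = m+n≤o⇒n≤o (suc y * r) bound
    r≤k : r ≤ k
    r≤k = ≤-trans (m≤n*m r (suc y)) yr≤k
    x′≡r : ∀ r′ → r′ ≡ r → x′ ≡ r
    x′≡r zero    refl = ∈-zeroVectorArea⁻ k′ x′∈
    x′≡r (suc _) refl with k <? j
    ... | yes k<j = ∈-areasWith-wide p j r (≤-<-trans k′≤k k<j) (≤-trans (m+n≤o⇒n≤o j (≤-reflexive j+r≡m)) (<⇒≤ (m+n≤o⇒n≤o y (≤-reflexive y+m≡p)))) x′∈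
    ... | no k≮j = contradiction yr≤k (<⇒≱ (y*r-large (s≤s z≤n) (s≤s z≤n) (+-cancelˡ-≤ k (k + 2) (suc y + r) (begin
      k + (k + 2)     ≡⟨ +-assoc k k 2 ⟨
      k + k + 2       ≤⟨ ≤-trans (+-monoʳ-≤ (k + k) (n≤1+n 2)) large ⟩
      p               ≡⟨ y+m≡p ⟨
      y + suc m       ≡⟨ cong (λ m → y + suc m) j+r≡m ⟨
      y + suc (j + r) ≡⟨ +-suc y (j + r) ⟩
      suc (y + (j + r)) ≡⟨ cong suc (trans (sym (+-assoc y j r)) (trans (cong (_+ r) (+-comm y j)) (+-assoc j y r))) ⟩
      suc (j + (y + r)) ≡⟨ +-suc j (y + r) ⟨
      j + (suc y + r) ≤⟨ +-monoˡ-≤ (suc y + r) (≮⇒≥ k≮j) ⟩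
      k + (suc y + r) ∎))))

  -- In this range of areas only vectors with a single zero occur.
  count-high : ∀ a → k ≤ a → count (suc p) (suc p + a) ≡ count p a
  count-high a k≤a = begin
    count (suc p) (suc p + a)
      ≡⟨ cong (cnt (suc p + a)) (areas-suc p k) ⟩
    cnt (suc p + a) (map (suc p +_) (areas p k) ++ areas≥2zeros p k)
      ≡⟨ cnt-++ (suc p + a) (map (suc p +_) (areas p k)) _ ⟩
    cnt (suc p + a) (map (suc p +_) (areas p k)) + cnt (suc p + a) (areas≥2zeros p k)
      ≡⟨ cong₂ _+_ (cnt-map-+ (suc p) a (areas p k))
           (cnt-∉ _ (areas≥2zeros p k) λ x∈ → <⇒≢ (<-≤-trans (areas≥2zeros-bounded x∈) (+-monoʳ-≤ (suc p) k≤a))) ⟩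
    count p a + 0
      ≡⟨ +-identityʳ _ ⟩
    count p a ∎
    where open ≡-Reasoning

  -- For `y > 0` the block is empty, since `y * r` exceeds `k`. For `y = 0` the product gives no
  -- bound, but all areas of the block are at least `suc m + r`.
  areaBlock-vanish : ∀ f y m j r a → y ≤ k → k + 2 ≤ y + r → (y ≡ 0 → a < suc m + r) → cnt a (areaBlock f y m k j r) ≡ 0
  areaBlock-vanish f zero m j r a _ _ small = cnt-∉ a _ λ x∈ → λ where refl → large-entry x∈
    where
    large-entry : ¬ (a ∈ areaBlock f 0 m k j r)
    large-entry a∈ with ∈-areaBlock⁻ f 0 m k j r a∈
    ... | record { k′ = k′ ; x′∈ = x′∈ ; shift = refl } =
      <⇒≱ (small refl) (+-monoʳ-≤ (suc m) (∈-areasWith⇒≤ f j r k′ x′∈))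
  areaBlock-vanish f (suc y) m j r a y≤k wide _ =
    cong (cnt a) (areaBlock-[] f (suc y) m k j r (y*r-large (s≤s z≤n) 1≤r wide))
    where
    1≤r : 1 ≤ r
    1≤r = ≤-trans (s≤s z≤n) (+-cancelˡ-≤ k 2 r (≤-trans wide (+-monoˡ-≤ r y≤k)))

  -- Blocks with `k < j` correspond under the insertion of a 1, which raises `j` by one. For `j ≤ k`
  -- the number `r` is large, so the blocks contribute nothing on either side; the same holds for
  -- the block `j = 0` of the longer vectors, which has no partner.
  areasWith-narrow : ∀ f y m a → suc f ≡ p → y ≤ k → y + suc m ≡ suc f → suc a ≤ suc f + k →
    cnt (suc a) (areasWith (suc (suc f)) y (suc (suc m)) k) ≡ cnt a (areasWith (suc f) y (suc m) k)
  areasWith-narrow f y m a refl y≤k y+m≡f a≤ = begin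
    cnt (suc a) (areasWith (suc (suc f)) y (suc (suc m)) k)
      ≡⟨ cnt-++ (suc a) (areaBlock (suc f) y (suc m) k 0 (suc m)) _ ⟩
    cnt (suc a) (areaBlock (suc f) y (suc m) k 0 (suc m)) +
    cnt (suc a) (concatMap (λ (j , r) → areaBlock (suc f) y (suc m) k j r) (map (λ (y , m) → suc y , m) (diag m)))
      ≡⟨ cong₂ _+_ (areaBlock-vanish (suc f) y (suc m) 0 (suc m) (suc a) y≤k first-wide first-small)
                   (cong (cnt (suc a)) (concatMap-map _ _ (diag m))) ⟩
    cnt (suc a) (concatMap (λ (j , r) → areaBlock (suc f) y (suc m) k (suc j) r) (diag m))
      ≡⟨ cnt-concatMap-cong (diag m) (λ {(j , r)} jr∈ → term j r (∈-diag⁻ m jr∈)) ⟩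
    cnt a (areasWith (suc f) y (suc m) k) ∎
    where
    open ≡-Reasoning
    k+k+2≤f : k + (k + 2) ≤ f
    k+k+2≤f = ≤-pred (subst (_≤ suc f) (trans (+-suc (k + k) 2) (cong suc (+-assoc k k 2))) large)
    k+2≤f : k + 2 ≤ f
    k+2≤f = m+n≤o⇒n≤o k k+k+2≤f
    first-wide : k + 2 ≤ y + suc m
    first-wide = ≤-trans (m≤n⇒m≤1+n k+2≤f) (≤-reflexive (sym y+m≡f))
    y+m≡ : y + m ≡ f
    y+m≡ = suc-injective (trans (sym (+-suc y m)) y+m≡f)
    m≤f : m ≤ f
    m≤f = m+n≤o⇒n≤o y (≤-reflexive y+m≡)
    first-small : y ≡ 0 → suc a < suc (suc m) + suc m
    first-small refl = s≤s (≤-trans a≤ (+-mono-≤ (≤-reflexive (sym y+m≡f)) (≤-trans (m+n≤o⇒m≤o k k+2≤f) (≤-trans (≤-reflexive (sym y+m≡)) (n≤1+n m)))))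
    term : ∀ j r → j + r ≡ m → cnt (suc a) (areaBlock (suc f) y (suc m) k (suc j) r) ≡ cnt a (areaBlock f y m k j r)
    term j r j+r≡m with k <? j
    ... | yes k<j = trans (cong (cnt (suc a)) (areaBlock-stable f y m k j r k<j (≤-trans (m+n≤o⇒n≤o j (≤-reflexive j+r≡m)) m≤f)))
                          (cnt-map-+ 1 a (areaBlock f y m k j r))
    ... | no k≮j = trans (areaBlock-vanish (suc f) y (suc m) (suc j) r (suc a) y≤k wide (s≤s ∘ small))
                         (sym (areaBlock-vanish f y m j r a y≤k wide small))
      where
      j≤k : j ≤ k
      j≤k = ≮⇒≥ k≮j
      wide : k + 2 ≤ y + r
      wide = +-cancelˡ-≤ k (k + 2) (y + r) (≤-trans k+k+2≤f (≤-trans (≤-reflexive (begin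
        f           ≡⟨ y+m≡ ⟨
        y + m       ≡⟨ cong (y +_) j+r≡m ⟨
        y + (j + r) ≡⟨ +-assoc y j r ⟨
        y + j + r   ≡⟨ cong (_+ r) (+-comm y j) ⟩
        j + y + r   ≡⟨ +-assoc j y r ⟩
        j + (y + r) ∎)) (+-monoˡ-≤ (y + r) j≤k)))
      small : y ≡ 0 → a < suc m + r
      small refl = ≤-trans a≤ (subst (λ z → suc z + k ≤ suc m + r) y+m≡ (+-monoʳ-≤ (suc m) (m+n≤o⇒m≤o k wide)))

  count-mid : ∀ a → p ≤ a + k + 1 → suc a ≤ p + k → count (suc p) (suc a) ≡ count p a
  count-mid a lower upper = begin
    count (suc p) (suc a)
      ≡⟨ cong (cnt (suc a) ∘ concatMap (λ (y , m) → areasWith (suc p) y m k)) (diag-∷ʳ p) ⟩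
    cnt (suc a) (concatMap (λ (y , m) → areasWith (suc p) y m k) (map (λ (y , m) → y , suc m) (diag p) ++ [ suc p , 0 ]))
      ≡⟨ cong (cnt (suc a)) (concatMap-++ _ (map (λ (y , m) → y , suc m) (diag p)) _) ⟩
    cnt (suc a) (concatMap (λ (y , m) → areasWith (suc p) y m k) (map (λ (y , m) → y , suc m) (diag p)) ++ (zeroVectorArea k ++ []))
      ≡⟨ cnt-++ (suc a) (concatMap _ (map (λ (y , m) → y , suc m) (diag p))) _ ⟩
    cnt (suc a) (concatMap (λ (y , m) → areasWith (suc p) y m k) (map (λ (y , m) → y , suc m) (diag p))) + cnt (suc a) (zeroVectorArea k ++ [])
      -- The pair `(suc p , 0)` yields at most the zero vector, whose area is not `suc a`.
      ≡⟨ cong₂ _+_ (cong (cnt (suc a)) (concatMap-map _ _ (diag p))) (all-zeros k) ⟩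
    cnt (suc a) (concatMap (λ (y , m) → areasWith (suc p) y (suc m) k) (diag p)) + 0
      ≡⟨ +-identityʳ _ ⟩
    cnt (suc a) (concatMap (λ (y , m) → areasWith (suc p) y (suc m) k) (diag p))
      ≡⟨ cnt-concatMap-cong (diag p) (λ {(y , m)} ym∈ → term y m (∈-diag⁻ p ym∈)) ⟩
    count p a ∎
    where
    open ≡-Reasoning
    all-zeros : ∀ k → cnt (suc a) (zeroVectorArea k ++ []) ≡ 0
    all-zeros zero    = refl
    all-zeros (suc _) = refl
    k≤a : k ≤ a
    k≤a = +-cancelʳ-≤ (k + 1) k a (≤-trans (≤-trans (≤-reflexive (sym (+-assoc k k 1))) (+-monoʳ-≤ (k + k) (s≤s z≤n)))
            (≤-trans large (≤-trans lower (≤-reflexive (+-assoc a k 1)))))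
    term : ∀ y m → y + m ≡ p → cnt (suc a) (areasWith (suc p) y (suc m) k) ≡ cnt a (areasWith p y m k)
    term y m y+m≡p with k <? y | k ≤? m
    ... | yes k<y | yes k≤m = trans (cong (cnt (suc a)) (areasWith-stableᵐ p y m k<y k≤m (m+n≤o⇒n≤o y (≤-reflexive y+m≡p)))) (cnt-map-+ 1 a (areasWith p y m k))
    -- All areas are `suc m` on the left and `m` on the right, while `m < k ≤ a`; both counts are 0.
    ... | yes k<y | no k≰m =
      trans (cnt-∉ (suc a) _ λ x∈ x≡ → m≢a (suc-injective (trans (sym (∈-areasWith-wide (suc p) y (suc m) k<y (s≤s m≤p) x∈)) x≡)))
            (sym (cnt-∉ a _ λ x∈ x≡ → m≢a (trans (sym (∈-areasWith-wide p y m k<y m≤p x∈)) x≡)))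
      where
      m≤p = m+n≤o⇒n≤o y (≤-reflexive y+m≡p)
      m≢a : m ≢ a
      m≢a = <⇒≢ (<-≤-trans (≰⇒> k≰m) k≤a)
    ... | no k≮y | _ = narrow m p refl y+m≡p
      where
      narrow : ∀ m q → q ≡ p → y + m ≡ q → cnt (suc a) (areasWith (suc q) y (suc m) k) ≡ cnt a (areasWith q y m k)
      narrow (suc m) (suc f) eq e = areasWith-narrow f y m a eq (≮⇒≥ k≮y) e (subst (λ q → suc a ≤ q + k) (sym eq) upper)
      narrow (suc m) zero    eq e = contradiction (trans (sym (+-suc y m)) e) λ ()
      -- No nonzero entry would mean `p ≡ y ≤ k`, against `large`.
      narrow zero    q       refl e = contradiction (≤-trans large (≤-trans (≤-reflexive (trans (sym e) (+-identityʳ y))) (≮⇒≥ k≮y)))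
        (<⇒≱ (subst (k <_) (sym (+-assoc k k 3)) (m<m+n k (≤-trans (s≤s z≤n) (m≤n+m 3 k)))))

-- Symmetry of the area distribution

-- The binomial coefficient n over 2, so `tri n` is the triangular number of index n - 1.
tri : ℕ → ℕ
tri zero    = 0
tri (suc n) = n + tri n

-- A list is read as a polynomial by its coefficients, which are 0 beyond its end.
coeff : List ℕ → ℕ → ℕ
coeff []       a       = 0
coeff (c ∷ cs) zero    = c
coeff (c ∷ cs) (suc a) = coeff cs a

bump : ℕ → List ℕ → List ℕ
bump zero    []       = 1 ∷ []
bump zero    (c ∷ cs) = suc c ∷ cs
bump (suc x) []       = 0 ∷ bump x []
bump (suc x) (c ∷ cs) = c ∷ bump x cs

coeff-bump : ∀ x h a → coeff (bump x h) a ≡ (if x ≡ᵇ a then 1 else 0) + coeff h a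
coeff-bump zero    []       zero    = refl
coeff-bump zero    []       (suc a) = refl
coeff-bump zero    (c ∷ cs) zero    = refl
coeff-bump zero    (c ∷ cs) (suc a) = refl
coeff-bump (suc x) []       zero    = refl
coeff-bump (suc x) []       (suc a) = coeff-bump x [] a
coeff-bump (suc x) (c ∷ cs) zero    = refl
coeff-bump (suc x) (c ∷ cs) (suc a) = coeff-bump x cs a

coeff-foldr-bump : ∀ xs h a → coeff (foldr bump h xs) a ≡ cnt a xs + coeff h a
coeff-foldr-bump []       h a = refl
coeff-foldr-bump (x ∷ xs) h a = trans (coeff-bump x (foldr bump h xs) a)
  (trans (cong ((if x ≡ᵇ a then 1 else 0) +_) (coeff-foldr-bump xs h a)) (sym (+-assoc (if x ≡ᵇ a then 1 else 0) _ _)))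

coeff-shift : ∀ m xs h → (∀ a → cnt a xs ≡ coeff h a) → ∀ a → cnt a (map (m +_) xs) ≡ coeff (replicate m 0 ++ h) a
coeff-shift zero    xs h eq a       = trans (cong (cnt a) (map-id xs)) (eq a)
coeff-shift (suc m) xs h eq zero    = cnt-∉ 0 _ λ x∈ x≡0 → positive (subst (_∈ _) x≡0 x∈)
  where
  positive : ¬ (0 ∈ map (suc m +_) xs)
  positive 0∈ with ∈-map⁻ _ 0∈
  ... | _ , _ , ()
coeff-shift (suc m) xs h eq (suc a) = trans (cong (cnt (suc a)) (map-∘ xs)) (trans (cnt-map-+ 1 a (map (m +_) xs)) (coeff-shift m xs h eq a))

-- A vector with a single zero is 0 followed by a shifted vector of length p + 1, so only the
-- vectors with at least two zeros have to be enumerated anew.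
hist : ℕ → ℕ → List ℕ
hist zero    k = foldr bump [] (areas 0 k)
hist (suc p) k = foldr bump (replicate (suc p) 0 ++ hist p k) (areas≥2zeros p k)

coeff-hist : ∀ p k a → cnt a (areas p k) ≡ coeff (hist p k) a
coeff-hist zero    k a = sym (trans (coeff-foldr-bump (areas 0 k) [] a) (+-identityʳ _))
coeff-hist (suc p) k a = begin
  cnt a (areas (suc p) k)                                          ≡⟨ cong (cnt a) (areas-suc p k) ⟩
  cnt a (map (suc p +_) (areas p k) ++ areas≥2zeros p k)                   ≡⟨ cnt-++ a (map (suc p +_) (areas p k)) _ ⟩
  cnt a (map (suc p +_) (areas p k)) + cnt a (areas≥2zeros p k)            ≡⟨ cong (_+ cnt a (areas≥2zeros p k)) (coeff-shift (suc p) (areas p k) (hist p k) (coeff-hist p k) a) ⟩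
  coeff (replicate (suc p) 0 ++ hist p k) a + cnt a (areas≥2zeros p k)     ≡⟨ +-comm _ (cnt a (areas≥2zeros p k)) ⟩
  cnt a (areas≥2zeros p k) + coeff (replicate (suc p) 0 ++ hist p k) a     ≡⟨ coeff-foldr-bump (areas≥2zeros p k) _ a ⟨
  coeff (hist (suc p) k) a                                         ∎
  where open ≡-Reasoning

-- Evaluation of the short lengths

allBelow : ℕ → (ℕ → Bool) → Bool
allBelow zero    f = true
allBelow (suc n) f = f n ∧ allBelow n f

∧-true⁻ : ∀ x {y} → x ∧ y ≡ true → x ≡ true × y ≡ true
∧-true⁻ true y≡true = refl , y≡true

allBelow-sound : ∀ n f → allBelow n f ≡ true → ∀ {i} → i < n → f i ≡ true
allBelow-sound (suc n) f all≡ (s≤s i≤n) with ∧-true⁻ (f n) all≡ | m≤n⇒m<n∨m≡n i≤n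
... | _    , all′ | inj₁ i<n  = allBelow-sound n f all′ i<n
... | fn≡  , _    | inj₂ refl = fn≡

≡ᵇ-true⇒≡ : ∀ m n → (m ≡ᵇ n) ≡ true → m ≡ n
≡ᵇ-true⇒≡ m n eq = ≡ᵇ⇒≡ m n (subst T (sym eq) _)

symmetricᵇ : ℕ → List ℕ → Bool
symmetricᵇ D h = allBelow (suc D) λ a → coeff h a ≡ᵇ coeff h (D ∸ a)

-- With `D` the sum of area and dinv, `k + i` runs from `k` to `D ∸ k`.
flatᵇ : ℕ → ℕ → List ℕ → Bool
flatᵇ k D h = allBelow (suc (D ∸ k ∸ k)) λ i → coeff h (k + i) ≡ᵇ coeff h k

-- The range of `p` covers the lengths from 1 to 2k + 4.
all-symmetricᵇ : ℕ → Bool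
all-symmetricᵇ k = allBelow (k + k + 4) λ p → symmetricᵇ (tri (suc p) ∸ k) (hist p k)

baseᵇ : ℕ → Bool
baseᵇ k = all-symmetricᵇ k ∧ flatᵇ k (tri (k + k + 4) ∸ k) (hist (k + k + 3) k)

-- The bound 9 on k enters here: this finite computation is done by normalisation, while the passage
-- to longer vectors is uniform in k.
base-cases : allBelow 10 baseᵇ ≡ true
base-cases = refl

-- Propagation of symmetry to all lengths

Symmetric : ℕ → ℕ → Set
Symmetric k p = ∀ a b → a + b + k ≡ tri (suc p) → cnt a (areas p k) ≡ cnt b (areas p k)

-- With a + b = D, the two bounds say k ≤ a ≤ D - k without any subtraction.
Flat : ℕ → ℕ → ℕ → Set
Flat k c p = ∀ a b → a + b + k ≡ tri (suc p) → k ≤ a → k ≤ b → cnt a (areas p k) ≡ c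

module _ {k} (k≤9 : k ≤ 9) where

  private
    base-k = ∧-true⁻ (all-symmetricᵇ k) (allBelow-sound 10 baseᵇ base-cases (s≤s k≤9))

  symmetric-base : ∀ {p} → p < k + k + 4 → Symmetric k p
  symmetric-base {p} p< a b eq = begin
    cnt a (areas p k)      ≡⟨ coeff-hist p k a ⟩
    coeff (hist p k) a     ≡⟨ ≡ᵇ-true⇒≡ _ _ (allBelow-sound _ _ (allBelow-sound _ _ (proj₁ base-k) p<) a<) ⟩
    coeff (hist p k) (tri (suc p) ∸ k ∸ a) ≡⟨ cong (coeff (hist p k)) D∸a≡b ⟩
    coeff (hist p k) b     ≡⟨ coeff-hist p k b ⟨
    cnt b (areas p k)      ∎
    where
    open ≡-Reasoning
    D≡a+b : tri (suc p) ∸ k ≡ a + b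
    D≡a+b = trans (cong (_∸ k) (sym eq)) (m+n∸n≡m (a + b) k)
    a< : a < suc (tri (suc p) ∸ k)
    a< = s≤s (subst (a ≤_) (sym D≡a+b) (m≤m+n a b))
    D∸a≡b : tri (suc p) ∸ k ∸ a ≡ b
    D∸a≡b = trans (cong (_∸ a) D≡a+b) (m+n∸m≡n a b)

  flat-base : Flat k (coeff (hist (k + k + 3) k) k) (k + k + 3)
  flat-base a b eq k≤a k≤b = begin
    cnt a (areas p k)            ≡⟨ coeff-hist p k a ⟩
    coeff (hist p k) a           ≡⟨ cong (coeff (hist p k)) (m+[n∸m]≡n k≤a) ⟨
    coeff (hist p k) (k + (a ∸ k)) ≡⟨ ≡ᵇ-true⇒≡ _ _ (allBelow-sound _ _ (proj₂ base-k) i<) ⟩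
    coeff (hist p k) k           ∎
    where
    open ≡-Reasoning
    p = k + k + 3
    D≡a+b : tri (k + k + 4) ∸ k ≡ a + b
    D≡a+b = trans (cong (_∸ k) (trans (cong tri (+-suc (k + k) 3)) (sym eq))) (m+n∸n≡m (a + b) k)
    i< : a ∸ k < suc (tri (k + k + 4) ∸ k ∸ k ∸ k)
    i< = s≤s (∸-monoˡ-≤ k (m+n≤o⇒m≤o∸n a (subst (a + k ≤_) (sym D≡a+b) (+-monoʳ-≤ a k≤b))))

module _ (k p : ℕ) (large : k + k + 3 ≤ p) where
  open Step k p large

  private
    2[1+k]≤p : 2 + (k + k) ≤ p
    2[1+k]≤p = ≤-trans (≤-trans (≤-reflexive (+-comm 2 (k + k))) (+-monoʳ-≤ (k + k) (n≤1+n 2))) large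

    -- Ensures that p + k ≤ D - k for D = `tri (suc p)` - k, so that areas up to p + k do not leave
    -- the interval of `Flat` at its upper end.
    room : p + (k + k + k) ≤ tri (suc p)
    room = +-monoʳ-≤ p (tri-bound p 2[1+k]≤p)
      where
      tri-bound : ∀ p → 2 + (k + k) ≤ p → k + k + k ≤ tri p
      tri-bound (suc (suc q)) (s≤s (s≤s k+k≤q)) = ≤-trans (+-mono-≤ (m≤n⇒m≤1+n k+k≤q) (≤-trans (m≤m+n k k) k+k≤q)) (+-monoʳ-≤ (suc q) (m≤m+n q (tri q)))

    shift-total : ∀ {a b} → suc p + a + b + k ≡ tri (suc (suc p)) → a + b + k ≡ tri (suc p)
    shift-total {a} {b} eq = +-cancelˡ-≡ (suc p) _ _ (trans (sym (trans (+-assoc (suc p + a) b k)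
      (trans (+-assoc (suc p) a (b + k)) (cong (suc p +_) (sym (+-assoc a b k)))))) eq)

    complement : ∀ a → a ≤ p + k → ∃[ b ] a + b + k ≡ tri (suc p) × k ≤ b
    complement a a≤ = tri (suc p) ∸ k ∸ a , total , k≤b
      where
      a+k+k≤ : a + k + k ≤ tri (suc p)
      a+k+k≤ = ≤-trans (+-monoˡ-≤ k (+-monoˡ-≤ k a≤)) (≤-trans (≤-reflexive (trans (cong (_+ k) (+-assoc p k k)) (+-assoc p (k + k) k))) room)
      a+k≤ : a + k ≤ tri (suc p) ∸ k
      a+k≤ = m+n≤o⇒m≤o∸n (a + k) a+k+k≤
      total : a + (tri (suc p) ∸ k ∸ a) + k ≡ tri (suc p)
      total = trans (cong (_+ k) (m+[n∸m]≡n (m+n≤o⇒m≤o a a+k≤))) (m∸n+n≡m (m+n≤o⇒n≤o (a + k) a+k+k≤))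
      k≤b : k ≤ tri (suc p) ∸ k ∸ a
      k≤b = m+n≤o⇒m≤o∸n k (≤-trans (≤-reflexive (+-comm k a)) a+k≤)

    split-high : ∀ {a} → suc p + k ≤ a → ∃[ a′ ] a ≡ suc p + a′ × k ≤ a′
    split-high {a} high = a ∸ suc p , a≡ , +-cancelˡ-≤ (suc p) k _ (≤-trans high (≤-reflexive a≡))
      where
      a≡ : a ≡ suc p + (a ∸ suc p)
      a≡ = sym (m+[n∸m]≡n (m+n≤o⇒m≤o (suc p) high))

  -- The high, low and middle ranges cover all `a`. In each, the corresponding area at the shorter
  -- length again lies in the interval where the counts equal `c`.
  flat-step : ∀ {c} → Flat k c p → Flat k c (suc p)
  flat-step {c} flat a b eq k≤a k≤b with suc p + k ≤? a
  ... | yes high with split-high high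
  ...   | a′ , refl , k≤a′ = trans (count-high a′ k≤a′) (flat a′ b (shift-total eq) k≤a′ k≤b)
  flat-step {c} flat a b eq k≤a k≤b | no ¬high with a + k + 1 ≤? p
  ...   | yes low with complement a (≤-pred (≰⇒> ¬high))
  ...     | b′ , total , k≤b′ = trans (count-low a low) (flat a b′ total k≤a k≤b′)
  -- Area 0 belongs to the low range, because `k + 1 ≤ p`.
  flat-step {c} flat zero b eq k≤a k≤b | no ¬high | no ¬low =
    contradiction (≤-trans (≤-trans (≤-reflexive (+-comm k 1)) (s≤s (≤-trans (m≤m+n k k) (n≤1+n _)))) 2[1+k]≤p) ¬low
  flat-step {c} flat (suc a) b eq k≤a k≤b | no ¬high | no ¬low with complement a (≤-trans (n≤1+n a) (≤-pred (≰⇒> ¬high)))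
  ...     | b′ , total , k≤b′ = trans (count-mid a p≤ (≤-pred (≰⇒> ¬high))) (flat a b′ total k≤a′ k≤b′)
    where
    p≤ : p ≤ a + k + 1
    p≤ = ≤-pred (≰⇒> ¬low)
    k≤a′ : k ≤ a
    k≤a′ = +-cancelʳ-≤ (k + 1) k a (≤-trans (≤-reflexive (trans (sym (+-assoc k k 1)) (+-comm (k + k) 1)))
             (≤-trans (n≤1+n _) (≤-trans 2[1+k]≤p (≤-trans p≤ (≤-reflexive (+-assoc a k 1))))))

  -- A small `a` forces `b` into the high range. Removing the appended 0 on one side and the
  -- prepended 0 on the other reduces the claim to symmetry one length below.
  low-high : Symmetric k p → ∀ a b → a + b + k ≡ tri (suc (suc p)) → a < k → count (suc p) a ≡ count (suc p) b
  low-high symm a b eq a<k with split-high {b} high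
    where
    open ≤-Reasoning
    high : suc p + k ≤ b
    high = +-cancelˡ-≤ (k + k) (suc p + k) b (begin
      k + k + (suc p + k)     ≡⟨ cong (k + k +_) (+-comm (suc p) k) ⟩
      k + k + (k + suc p)     ≡⟨ +-assoc (k + k) k (suc p) ⟨
      k + k + k + suc p       ≡⟨ +-comm (k + k + k) (suc p) ⟩
      suc p + (k + k + k)     ≤⟨ +-monoʳ-≤ (suc p) (≤-trans (m≤n+m _ p) room) ⟩
      tri (suc (suc p))       ≡⟨ eq ⟨
      a + b + k               ≤⟨ +-monoˡ-≤ k (+-monoˡ-≤ b (<⇒≤ a<k)) ⟩
      k + b + k               ≡⟨ +-assoc k b k ⟩
      k + (b + k)             ≡⟨ cong (k +_) (+-comm b k) ⟩
      k + (k + b)             ≡⟨ +-assoc k k b ⟨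
      k + k + b               ∎)
  ... | b′ , refl , k≤b′ = trans (count-low a low) (trans (symm a b′ total) (sym (count-high b′ k≤b′)))
    where
    low : a + k + 1 ≤ p
    low = ≤-trans (≤-reflexive (+-comm (a + k) 1)) (≤-trans (s≤s (≤-trans (+-monoˡ-≤ k (<⇒≤ a<k)) (n≤1+n (k + k)))) 2[1+k]≤p)
    total : a + b′ + k ≡ tri (suc p)
    total = trans (cong (_+ k) (+-comm a b′)) (shift-total (trans (cong (_+ k) (+-comm (suc p + b′) a)) eq))

  symmetric-step : ∀ {c} → Flat k c p → Symmetric k p → Symmetric k (suc p)
  symmetric-step flat symm a b eq with k ≤? a | k ≤? b
  ... | yes k≤a | yes k≤b = trans (flat-step flat a b eq k≤a k≤b) (sym (flat-step flat b a (trans (cong (_+ k) (+-comm b a)) eq) k≤b k≤a))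
  ... | no k≰a  | _       = low-high symm a b eq (≰⇒> k≰a)
  ... | yes _   | no k≰b  = sym (low-high symm b a (trans (cong (_+ k) (+-comm b a)) eq) (≰⇒> k≰b))

symmetric-areas : ∀ {k} → k ≤ 9 → ∀ p → Symmetric k p
symmetric-areas {k} k≤9 p with p <? k + k + 4
... | yes p< = symmetric-base k≤9 p<
-- The induction starts at `k + k + 3`, the last evaluated `p`, where both symmetry and constancy
-- are known.
... | no p≮  = subst (Symmetric k) (m∸n+n≡m (≤-trans (+-monoʳ-≤ (k + k) (n≤1+n 3)) (≮⇒≥ p≮))) (proj₂ (from-base (p ∸ (k + k + 3))))
  where
  from-base : ∀ d → Flat k (coeff (hist (k + k + 3) k) k) (d + (k + k + 3)) × Symmetric k (d + (k + k + 3))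
  from-base zero    = flat-base k≤9 , symmetric-base k≤9 (+-monoʳ-< (k + k) (n<1+n 3))
  from-base (suc d) with from-base d
  ... | flat , symm = flat-step k _ large flat , symmetric-step k _ large flat symm
    where large = m≤n+m (k + k + 3) d

-- Decomposition of a Dyck vector by its zeros

strip : List ℕ → List ℕ
strip []          = []
strip (zero  ∷ v) = strip v
strip (suc x ∷ v) = x ∷ strip v

-- `false` stands for an entry 0 and `true` for an entry 1; larger entries leave no letter.
shape : List ℕ → List Bool
shape []                = []
shape (zero        ∷ v) = false ∷ shape v
shape (suc zero    ∷ v) = true ∷ shape v
shape (suc (suc x) ∷ v) = shape v

-- Entries of w that are nonzero cannot follow a 0 of the merged vector, so they are output first.
-- The last clause is only reached when σ has more ones than w has zeros.
merge : List Bool → List ℕ → List ℕ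
merge []          w           = map suc w
merge (b     ∷ σ) (suc x ∷ w) = suc (suc x) ∷ merge (b ∷ σ) w
merge (false ∷ σ) (zero  ∷ w) = 0 ∷ merge σ (0 ∷ w)
merge (true  ∷ σ) (zero  ∷ w) = 1 ∷ merge σ w
merge (false ∷ σ) []          = 0 ∷ merge σ []
merge (true  ∷ σ) []          = []

-- Inversions of binary words

ones zeros inv01 inv10 : List Bool → ℕ
ones []          = 0
ones (true  ∷ σ) = suc (ones σ)
ones (false ∷ σ) = ones σ
zeros []          = 0
zeros (true  ∷ σ) = zeros σ
zeros (false ∷ σ) = suc (zeros σ)
inv01 []          = 0
inv01 (true  ∷ σ) = inv01 σ
inv01 (false ∷ σ) = ones σ + inv01 σ
inv10 []          = 0
inv10 (true  ∷ σ) = zeros σ + inv10 σ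
inv10 (false ∷ σ) = inv10 σ

+-swapˡ : ∀ a b c → a + (b + c) ≡ b + (a + c)
+-swapˡ = solve-∀

inv10+inv01 : ∀ σ → inv10 σ + inv01 σ ≡ zeros σ * ones σ
inv10+inv01 []          = refl
inv10+inv01 (true  ∷ σ) = begin
  zeros σ + inv10 σ + inv01 σ     ≡⟨ +-assoc (zeros σ) _ _ ⟩
  zeros σ + (inv10 σ + inv01 σ)   ≡⟨ cong (zeros σ +_) (inv10+inv01 σ) ⟩
  zeros σ + zeros σ * ones σ      ≡⟨ *-suc (zeros σ) (ones σ) ⟨
  zeros σ * suc (ones σ)          ∎
  where open ≡-Reasoning
inv10+inv01 (false ∷ σ) = begin
  inv10 σ + (ones σ + inv01 σ)    ≡⟨ +-swapˡ (inv10 σ) (ones σ) (inv01 σ) ⟩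
  ones σ + (inv10 σ + inv01 σ)    ≡⟨ cong (ones σ +_) (inv10+inv01 σ) ⟩
  ones σ + zeros σ * ones σ       ∎
  where open ≡-Reasoning

-- Effect of `strip` on length, area, dinv and deficit

zeros-shape : ∀ v → zeros (shape v) ≡ cnt 0 v
zeros-shape []                = refl
zeros-shape (zero        ∷ v) = cong suc (zeros-shape v)
zeros-shape (suc zero    ∷ v) = zeros-shape v
zeros-shape (suc (suc x) ∷ v) = zeros-shape v

ones-shape : ∀ v → ones (shape v) ≡ cnt 0 (strip v)
ones-shape []                = refl
ones-shape (zero        ∷ v) = ones-shape v
ones-shape (suc zero    ∷ v) = cong suc (ones-shape v)
ones-shape (suc (suc x) ∷ v) = ones-shape v

length-strip : ∀ v → length v ≡ cnt 0 v + length (strip v)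
length-strip []          = refl
length-strip (zero  ∷ v) = cong suc (length-strip v)
length-strip (suc x ∷ v) = trans (cong suc (length-strip v)) (sym (+-suc (cnt 0 v) _))

area-strip : ∀ v → area v ≡ length (strip v) + area (strip v)
area-strip []          = refl
area-strip (zero  ∷ v) = area-strip v
area-strip (suc x ∷ v) = cong suc (trans (cong (x +_) (area-strip v)) (+-swapˡ x (length (strip v)) (area (strip v))))

near : ℕ → List ℕ → ℕ
near x v = length (filterᵇ (diffIn01 x) v)

near-∷ : ∀ x z v → near x (z ∷ v) ≡ (if (x ≡ᵇ z) ∨ (x ≡ᵇ suc z) then 1 else 0) + near x v
near-∷ x z v rewrite isYes≗does (x ≟ z) | isYes≗does (x ≟ suc z) with (x ≡ᵇ z) ∨ (x ≡ᵇ suc z)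
... | true  = refl
... | false = refl

near-0 : ∀ v → near 0 v ≡ cnt 0 v
near-0 []          = refl
near-0 (zero  ∷ v) = trans (near-∷ 0 0 v) (cong suc (near-0 v))
near-0 (suc x ∷ v) = trans (near-∷ 0 (suc x) v) (near-0 v)

near-1 : ∀ v → near 1 v ≡ cnt 0 v + near 0 (strip v)
near-1 []          = refl
near-1 (zero  ∷ v) = trans (near-∷ 1 0 v) (cong suc (near-1 v))
near-1 (suc x ∷ v) = begin
  near 1 (suc x ∷ v)                        ≡⟨ near-∷ 1 (suc x) v ⟩
  here? + near 1 v                          ≡⟨ cong (here? +_) (near-1 v) ⟩
  here? + (cnt 0 v + near 0 (strip v))      ≡⟨ +-swapˡ here? (cnt 0 v) (near 0 (strip v)) ⟩
  cnt 0 v + (here? + near 0 (strip v))      ≡⟨ cong (cnt 0 v +_) (near-∷ 0 x (strip v)) ⟨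
  cnt 0 v + near 0 (x ∷ strip v)            ∎
  where
  open ≡-Reasoning
  here? = if (0 ≡ᵇ x) ∨ (0 ≡ᵇ suc x) then 1 else 0

near-2+ : ∀ x v → near (suc (suc x)) v ≡ near (suc x) (strip v)
near-2+ x []          = refl
near-2+ x (zero  ∷ v) = trans (near-∷ (suc (suc x)) 0 v) (near-2+ x v)
near-2+ x (suc z ∷ v) = trans (near-∷ (suc (suc x)) (suc z) v)
  (trans (cong ((if (suc x ≡ᵇ z) ∨ (x ≡ᵇ z) then 1 else 0) +_) (near-2+ x v)) (sym (near-∷ (suc x) z (strip v))))

-- Pairs of nonzero entries survive in `strip v`, and every pair of zeros counts. A mixed pair
-- counts only if it is a 1 before a 0.
dinv-strip : ∀ v → dinv v ≡ dinv (strip v) + tri (cnt 0 v) + inv10 (shape v)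
dinv-strip []                = refl
dinv-strip (zero        ∷ v) rewrite near-0 v | dinv-strip v =
  lemma (cnt 0 v) (dinv (strip v)) (tri (cnt 0 v)) (inv10 (shape v))
  where
  lemma : ∀ a b c d → a + (b + c + d) ≡ b + (a + c) + d
  lemma = solve-∀
dinv-strip (suc zero    ∷ v) rewrite near-1 v | dinv-strip v | zeros-shape v =
  lemma (cnt 0 v) (near 0 (strip v)) (dinv (strip v)) (tri (cnt 0 v)) (inv10 (shape v))
  where
  lemma : ∀ a b c d e → a + b + (c + d + e) ≡ b + c + d + (a + e)
  lemma = solve-∀
dinv-strip (suc (suc x) ∷ v) rewrite near-2+ x v | dinv-strip v =
  lemma (near (suc x) (strip v)) (dinv (strip v)) (tri (cnt 0 v)) (inv10 (shape v))
  where
  lemma : ∀ a b c d → a + (b + c + d) ≡ a + b + c + d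
  lemma = solve-∀

-- A relation, so that no subtraction occurs; `Def-unique` and `Dyck⇒Def` make it a function on Dyck
-- vectors.
Def : ℕ → List ℕ → Set
Def k v = tri (length v) ≡ area v + dinv v + k

Def-unique : ∀ v {k l} → Def k v → Def l v → k ≡ l
Def-unique v dk dl = +-cancelˡ-≡ (area v + dinv v) _ _ (trans (sym dk) dl)

tri-+ : ∀ m n → tri (m + n) ≡ tri m + tri n + m * n
tri-+ zero    n = sym (+-identityʳ (tri n))
tri-+ (suc m) n rewrite tri-+ m n = lemma m n (tri m) (tri n)
  where
  lemma : ∀ m n a b → m + n + (a + b + m * n) ≡ m + a + b + (n + m * n)
  lemma = solve-∀

-- The loss of area pays for the pairs of the leading 0 with nonzero entries. Among pairs of a later
-- 0 with a nonzero entry, those with an entry at least 2 are all lost, which gives y r, and those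
-- with a 1 are lost exactly when the 0 comes first, which gives `inv01`.
Def-strip : ∀ v k → Def k (strip v) →
  Def (cnt 0 v * length (strip (strip v)) + (inv01 (shape v) + k)) (0 ∷ v)
Def-strip v k def rewrite area-strip v | near-0 v | dinv-strip v | length-strip v = begin
  y + n + tri (y + n)
    ≡⟨ cong (y + n +_) (tri-+ y n) ⟩
  y + n + (tri y + tri n + y * n)
    ≡⟨ cong₂ (λ d e → y + n + (tri y + d + y * e)) def (length-strip (strip v)) ⟩
  y + n + (tri y + (a + d + k) + y * (o + r))
    ≡⟨ lemma₁ y n (tri y) a d k o r ⟩
  n + a + (y + (d + tri y)) + (y * r + k) + y * o
    ≡⟨ cong (n + a + (y + (d + tri y)) + (y * r + k) +_) yo ⟩
  n + a + (y + (d + tri y)) + (y * r + k) + (i + i′)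
    ≡⟨ lemma₂ n a y d (tri y) (y * r) k i i′ ⟩
  n + a + (y + (d + tri y + i)) + (y * r + (i′ + k)) ∎
  where
  open ≡-Reasoning
  y = cnt 0 v
  n = length (strip v)
  a = area (strip v)
  d = dinv (strip v)
  o = cnt 0 (strip v)
  r = length (strip (strip v))
  i = inv10 (shape v)
  i′ = inv01 (shape v)
  yo : y * o ≡ i + i′
  yo = sym (trans (inv10+inv01 (shape v)) (cong₂ _*_ (zeros-shape v) (ones-shape v)))
  lemma₁ : ∀ y n t a d k o r → y + n + (t + (a + d + k) + y * (o + r)) ≡ n + a + (y + (d + t)) + (y * r + k) + y * o
  lemma₁ = solve-∀
  lemma₂ : ∀ n a y d t yr k i i′ → n + a + (y + (d + t)) + (yr + k) + (i + i′) ≡ n + a + (y + (d + t + i)) + (yr + (i′ + k))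
  lemma₂ = solve-∀

-- Dyck vectors as an inductive predicate, and `merge` as inverse of `strip`

data Steps : ℕ → List ℕ → Set where
  []  : ∀ {x} → Steps x []
  _∷_ : ∀ {x z v} → z ≤ suc x → Steps z v → Steps x (z ∷ v)

data Dyck : List ℕ → Set where
  empty : Dyck []
  cons  : ∀ {v} → Steps 0 v → Dyck (0 ∷ v)

Dyck⇒Steps : ∀ {x v} → Dyck v → Steps x v
Dyck⇒Steps empty     = []
Dyck⇒Steps (cons st) = z≤n ∷ st

-- After a 0 the next surviving entry is a 1 and becomes 0, so what follows a 0 strips to a Dyck
-- vector, whatever precedes it.
strip-Dyck  : ∀ {v} → Steps 0 v → Dyck (strip v)
strip-Steps : ∀ {x v} → Steps (suc x) v → Steps x (strip v)
strip-Dyck []                                  = empty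
strip-Dyck {zero        ∷ v} (_ ∷ st)          = strip-Dyck st
strip-Dyck {suc zero    ∷ v} (_ ∷ st)          = cons (strip-Steps st)
strip-Dyck {suc (suc _) ∷ v} (s≤s () ∷ st)
strip-Steps []                                 = []
strip-Steps {v = zero  ∷ v} (_ ∷ st)           = Dyck⇒Steps (strip-Dyck st)
strip-Steps {v = suc z ∷ v} (s≤s z≤x ∷ st)     = z≤x ∷ strip-Steps st

merge-false-Dyck : ∀ σ {w} → Dyck w → merge (false ∷ σ) w ≡ 0 ∷ merge σ w
merge-false-Dyck σ empty    = refl
merge-false-Dyck σ (cons _) = refl

merge-suc : ∀ σ x w → merge σ (suc x ∷ w) ≡ suc (suc x) ∷ merge σ w
merge-suc []      x w = refl
merge-suc (b ∷ σ) x w = refl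

merge-shape-strip : ∀ {x v} → Steps x v → merge (shape v) (strip v) ≡ v
merge-shape-strip []                              = refl
merge-shape-strip {v = zero        ∷ v} (_ ∷ st)  = trans (merge-false-Dyck (shape v) (strip-Dyck st)) (cong (0 ∷_) (merge-shape-strip st))
merge-shape-strip {v = suc zero    ∷ v} (_ ∷ st)  = cong (1 ∷_) (merge-shape-strip st)
merge-shape-strip {v = suc (suc x) ∷ v} (_ ∷ st)  = trans (merge-suc (shape v) x (strip v)) (cong (suc (suc x) ∷_) (merge-shape-strip st))

strip-merge : ∀ σ w → ones σ ≡ cnt 0 w → strip (merge σ w) ≡ w
strip-merge []          []          _  = refl
strip-merge []          (x ∷ w)     _  = cong (x ∷_) (strip-map-suc w)
  where
  strip-map-suc : ∀ w → strip (map suc w) ≡ w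
  strip-map-suc []      = refl
  strip-map-suc (x ∷ w) = cong (x ∷_) (strip-map-suc w)
strip-merge (b     ∷ σ) (suc x ∷ w) eq = cong (suc x ∷_) (strip-merge (b ∷ σ) w eq)
strip-merge (false ∷ σ) (zero  ∷ w) eq = strip-merge σ (0 ∷ w) eq
strip-merge (true  ∷ σ) (zero  ∷ w) eq = cong (0 ∷_) (strip-merge σ w (suc-injective eq))
strip-merge (false ∷ σ) []          eq = strip-merge σ [] eq

-- The matching numbers keep the recursion out of the last clause of `merge`, which would drop
-- letters of `σ`.
shape-merge : ∀ σ w → ones σ ≡ cnt 0 w → shape (merge σ w) ≡ σ
shape-merge []          []          _  = refl
shape-merge []          (suc x ∷ w) eq = shape-merge [] w eq
shape-merge (b     ∷ σ) (suc x ∷ w) eq = shape-merge (b ∷ σ) w eq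
shape-merge (false ∷ σ) (zero  ∷ w) eq = cong (false ∷_) (shape-merge σ (0 ∷ w) eq)
shape-merge (true  ∷ σ) (zero  ∷ w) eq = cong (true ∷_) (shape-merge σ w (suc-injective eq))
shape-merge (false ∷ σ) []          eq = cong (false ∷_) (shape-merge σ [] eq)

-- Once a 0 is written, the rest of `w` is empty or starts with 0, hence is Dyck; this is why the
-- two claims are proved together.
merge-Steps : ∀ σ {x w} → Steps x w → Steps (suc x) (merge σ w)
merge-Dyck  : ∀ σ {w} → Dyck w → Steps 0 (merge σ w)
merge-Steps []          []                       = []
merge-Steps []          (z≤ ∷ st)                = s≤s z≤ ∷ merge-Steps [] st
merge-Steps (false ∷ σ) []                       = z≤n ∷ merge-Dyck σ empty
merge-Steps (true  ∷ σ) []                       = []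
merge-Steps (b     ∷ σ) {w = suc _ ∷ _} (z≤ ∷ st) = s≤s z≤ ∷ merge-Steps (b ∷ σ) st
merge-Steps (false ∷ σ) {w = zero  ∷ _} (z≤ ∷ st) = z≤n ∷ merge-Dyck σ (cons st)
merge-Steps (true  ∷ σ) {w = zero  ∷ _} (z≤ ∷ st) = s≤s z≤n ∷ merge-Steps σ st
merge-Dyck []          empty     = []
merge-Dyck []          (cons st) = s≤s z≤n ∷ merge-Steps [] st
merge-Dyck (false ∷ σ) empty     = z≤n ∷ merge-Dyck σ empty
merge-Dyck (true  ∷ σ) empty     = []
merge-Dyck (false ∷ σ) (cons st) = z≤n ∷ merge-Dyck σ (cons st)
merge-Dyck (true  ∷ σ) (cons st) = s≤s z≤n ∷ merge-Steps σ st

-- Enumeration of Dyck vectors of given deficit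

prepend : Bool → List Bool × ℕ → List Bool × ℕ
prepend b (σ , k) = b ∷ σ , k

-- The words σ counted by remainders, each paired with k − inv σ.
words : ℕ → ℕ → ℕ → List (List Bool × ℕ)
words zero    zero    k = ([] , k) ∷ []
words zero    (suc y) k = map (prepend false) (words zero y k)
words (suc j) zero    k = map (prepend true) (words j zero k)
words (suc j) (suc y) k =
  map (prepend true) (words j (suc y) k) ++ concatMap (λ c → map (prepend false) (words (suc j) y c)) (sub (suc j) k)

-- `remainders` stops when one kind of letter is used up, as a single word without inversions is
-- left; `words` spells that word out.
remainders-words : ∀ j y k → map proj₂ (words j y k) ≡ remainders j y k
remainders-words zero    zero    k = refl
remainders-words zero    (suc y) k = trans (sym (map-∘ (words zero y k))) (remainders-words zero y k)
remainders-words (suc zero)    zero k = refl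
remainders-words (suc (suc j)) zero k = trans (sym (map-∘ (words (suc j) zero k))) (remainders-words (suc j) zero k)
remainders-words (suc j) (suc y) k = begin
  map proj₂ (map (prepend true) (words j (suc y) k) ++ concatMap (λ c → map (prepend false) (words (suc j) y c)) (sub (suc j) k))
    ≡⟨ map-++ proj₂ (map (prepend true) (words j (suc y) k)) _ ⟩
  map proj₂ (map (prepend true) (words j (suc y) k)) ++ map proj₂ (concatMap (λ c → map (prepend false) (words (suc j) y c)) (sub (suc j) k))
    ≡⟨ cong₂ _++_ (trans (sym (map-∘ (words j (suc y) k))) (remainders-words j (suc y) k))
        (trans (map-concatMap proj₂ _ (sub (suc j) k))
          (concatMap-cong (λ c → trans (sym (map-∘ (words (suc j) y c))) (remainders-words (suc j) y c)) (sub (suc j) k))) ⟩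
  remainders (suc j) (suc y) k ∎
  where open ≡-Reasoning

∈-words⁺ : ∀ σ k → (σ , k) ∈ words (ones σ) (zeros σ) (inv01 σ + k)
∈-words⁺ []          k = here refl
∈-words⁺ (true  ∷ σ) k with zeros σ | ∈-words⁺ σ k
... | zero  | σ∈ = ∈-map⁺ (prepend true) σ∈
... | suc y | σ∈ = ∈-++⁺ˡ (∈-map⁺ (prepend true) σ∈)
∈-words⁺ (false ∷ σ) k with ones σ | ∈-words⁺ σ k
... | zero  | σ∈ = ∈-map⁺ (prepend false) σ∈
... | suc j | σ∈ = ∈-++⁺ʳ (map (prepend true) (words j (suc (zeros σ)) (suc j + inv01 σ + k)))
  (concatMap-∈⁺ (λ c → map (prepend false) (words (suc j) (zeros σ) c))
    (subst (λ n → inv01 σ + k ∈ sub (suc j) n) (sym (+-assoc (suc j) (inv01 σ) k)) (∈-sub⁺ (suc j) (inv01 σ + k)))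
    (∈-map⁺ (prepend false) σ∈))

∈-words⁻ : ∀ j y k {σ k′} → (σ , k′) ∈ words j y k → ones σ ≡ j × zeros σ ≡ y × inv01 σ + k′ ≡ k
∈-words⁻ zero zero k (here refl) = refl , refl , refl
∈-words⁻ zero (suc y) k σ∈ with ∈-map⁻ (prepend false) σ∈
... | (σ , _) , σ∈′ , refl with ∈-words⁻ zero y k σ∈′
...   | o , z , i rewrite o = refl , cong suc z , i
∈-words⁻ (suc j) zero k σ∈ with ∈-map⁻ (prepend true) σ∈
... | (σ , _) , σ∈′ , refl with ∈-words⁻ j zero k σ∈′
...   | o , z , i = cong suc o , z , i
∈-words⁻ (suc j) (suc y) k σ∈ with ∈-++⁻ (map (prepend true) (words j (suc y) k)) σ∈
... | inj₁ p with ∈-map⁻ (prepend true) p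
...   | (σ , _) , σ∈′ , refl with ∈-words⁻ j (suc y) k σ∈′
...     | o , z , i = cong suc o , z , i
∈-words⁻ (suc j) (suc y) k σ∈ | inj₂ p with concatMap-∈⁻ (λ c → map (prepend false) (words (suc j) y c)) {sub (suc j) k} p
... | c , c∈ , q with ∈-map⁻ (prepend false) q
...   | (σ , k′) , σ∈′ , refl with ∈-words⁻ (suc j) y c σ∈′
...     | o , z , i = o , cong suc z , trans (+-assoc (ones σ) (inv01 σ) k′) (trans (cong₂ _+_ o i) (∈-sub⁻ (suc j) k c∈))

-- Absence of repetitions

unique-concatMap : (f : X → List Y) {xs : List X} → Unique xs → (∀ {x} → x ∈ xs → Unique (f x)) →
  (∀ {x z v} → x ∈ xs → z ∈ xs → v ∈ f x → v ∈ f z → x ≡ z) → Unique (concatMap f xs)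
unique-concatMap f []         _ _   = []
unique-concatMap f {x ∷ xs} (x∉ ∷ uxs) u sep =
  Unique.++⁺ (u (here refl)) (unique-concatMap f uxs (u ∘ there) (λ p q → sep (there p) (there q)))
    λ (v∈fx , v∈) → let (z , z∈ , v∈fz) = concatMap-∈⁻ f v∈ in
      All.lookup x∉ z∈ (sep (here refl) (there z∈) v∈fx v∈fz)

-- Injectivity is asked on members only: for `merge` it comes from `strip-merge`, whose hypothesis
-- is known for the listed vectors.
unique-map : (f : X → Y) {xs : List X} → Unique xs → (∀ {x z} → x ∈ xs → z ∈ xs → f x ≡ f z → x ≡ z) → Unique (map f xs)
unique-map f {xs} uxs inj = subst Unique (trans (sym (concatMap-map [_] f xs)) (concatMap-pure (map f xs)))
  (unique-concatMap ([_] ∘ f) uxs (λ _ → [] ∷ []) λ { x∈ z∈ (here refl) (here eq) → inj x∈ z∈ eq })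

unique-diag : ∀ p → Unique (diag p)
unique-diag zero    = [] ∷ []
unique-diag (suc p) = All.tabulate (λ ym∈ eq → 0≢suc (∈-map⁻ _ (subst (_∈ _) (sym eq) ym∈))) ∷
  Unique.map⁺ (λ where refl → refl) (unique-diag p)
  where
  0≢suc : ¬ (∃[ ym ] ym ∈ diag p × (0 , suc p) ≡ (suc (proj₁ ym) , proj₂ ym))
  0≢suc (_ , _ , ())

unique-sub : ∀ c k → Unique (sub c k)
unique-sub zero    k       = [] ∷ []
unique-sub (suc c) zero    = []
unique-sub (suc c) (suc k) = unique-sub c k

prepend-injective : ∀ b {s t} → prepend b s ≡ prepend b t → s ≡ t
prepend-injective b refl = refl

unique-words : ∀ j y k → Unique (words j y k)
unique-words zero    zero    k = [] ∷ []
unique-words zero    (suc y) k = Unique.map⁺ (prepend-injective false) (unique-words zero y k)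
unique-words (suc j) zero    k = Unique.map⁺ (prepend-injective true) (unique-words j zero k)
unique-words (suc j) (suc y) k = Unique.++⁺
  (Unique.map⁺ (prepend-injective true) (unique-words j (suc y) k))
  (unique-concatMap (λ c → map (prepend false) (words (suc j) y c)) (unique-sub (suc j) k)
    (λ {c} _ → Unique.map⁺ (prepend-injective false) (unique-words (suc j) y c))
    λ c∈ d∈ _ _ → +-cancelˡ-≡ (suc j) _ _ (trans (∈-sub⁻ (suc j) k c∈) (sym (∈-sub⁻ (suc j) k d∈))))
  λ (v∈ , v∈′) → disjoint v∈ v∈′
  where
  disjoint : ∀ {s} → s ∈ map (prepend true) (words j (suc y) k) →
             ¬ (s ∈ concatMap (λ c → map (prepend false) (words (suc j) y c)) (sub (suc j) k))
  disjoint p q with ∈-map⁻ (prepend true) p | concatMap-∈⁻ (λ c → map (prepend false) (words (suc j) y c)) {sub (suc j) k} q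
  ... | _ , _ , refl | c , _ , q′ with ∈-map⁻ (prepend false) q′
  ...   | _ , _ , ()

-- The recursion of `areasWith` with the vectors themselves: areas serve the computation, vectors
-- the comparison with `DV`.
vectorsWith : ℕ → ℕ → ℕ → ℕ → List (List ℕ)
vectorBlock : ℕ → ℕ → ℕ → ℕ → ℕ → List (List ℕ)
vectorsWith f       y zero    zero    = replicate (suc y) 0 ∷ []
vectorsWith f       y zero    (suc k) = []
vectorsWith zero    y (suc m) k       = []
vectorsWith (suc f) y (suc m) k       = concatMap (λ (j , r) → vectorBlock f y k j r) (diag m)

vectorBlock f y k j r = concatMap (λ (σ , k′) → map (merge (false ∷ σ)) (vectorsWith f j r k′)) (concatMap (words (suc j) y) (sub (y * r) k))

record Spec (y m k : ℕ) (v : List ℕ) : Set where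
  constructor spec
  field
    dyck         : Dyck v
    zeros≡       : cnt 0 v ≡ suc y
    nonzeros≡    : length (strip v) ≡ m
    def≡         : Def k v

ones≡0⇒inv01≡0 : ∀ σ → ones σ ≡ 0 → inv01 σ ≡ 0
ones≡0⇒inv01≡0 []          _  = refl
ones≡0⇒inv01≡0 (false ∷ σ) eq = cong₂ _+_ eq (ones≡0⇒inv01≡0 σ eq)

strip≡[]⇒replicate : ∀ v → strip v ≡ [] → v ≡ replicate (cnt 0 v) 0
strip≡[]⇒replicate []         _  = refl
strip≡[]⇒replicate (zero ∷ v) eq = cong (0 ∷_) (strip≡[]⇒replicate v eq)

strip≡[]⇒Def0 : ∀ v → strip v ≡ [] → Def 0 (0 ∷ v)
strip≡[]⇒Def0 v strip≡[] = subst (λ l → Def l (0 ∷ v)) deficit≡0 (Def-strip v 0 (subst (Def 0) (sym strip≡[]) refl))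
  where
  inv01≡0 : inv01 (shape v) ≡ 0
  inv01≡0 = ones≡0⇒inv01≡0 (shape v) (trans (ones-shape v) (cong (cnt 0) strip≡[]))
  deficit≡0 : cnt 0 v * length (strip (strip v)) + (inv01 (shape v) + 0) ≡ 0
  deficit≡0 = trans (cong₂ (λ w i → cnt 0 v * length (strip w) + (i + 0)) strip≡[] inv01≡0)
                    (trans (+-identityʳ _) (*-zeroʳ (cnt 0 v)))

-- The deficit is nonnegative, since it is a sum of natural numbers along repeated stripping. The
-- fuel `f` bounds the length, which drops as the leading 0 is deleted.
Dyck⇒Def : ∀ f {v} → length v ≤ f → Dyck v → ∃[ k ] Def k v
Dyck⇒Def f       _           empty              = 0 , refl
Dyck⇒Def (suc f) (s≤s v≤f) (cons {v} st) with Dyck⇒Def f (≤-trans (m+n≤o⇒n≤o (cnt 0 v) (≤-reflexive (sym (length-strip v)))) v≤f) (strip-Dyck st)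
... | k , def = _ , Def-strip v k def

length≡0⇒[] : (v : List ℕ) → length v ≡ 0 → v ≡ []
length≡0⇒[] [] _ = refl

vectorsWith-complete : ∀ f y m k {v} → m ≤ f → Spec y m k v → v ∈ vectorsWith f y m k
vectorsWith-complete f y zero k {_} m≤f (spec (cons {v} st) z≡ n≡ def) with strip≡[] ← length≡0⇒[] (strip v) n≡ =
  subst₂ (λ k v → v ∈ vectorsWith f y 0 k) 0≡k (sym (trans (strip≡[]⇒replicate (0 ∷ v) strip≡[]) (cong (λ n → replicate n 0) z≡))) (here refl)
  where
  0≡k : 0 ≡ k
  0≡k = Def-unique (0 ∷ v) (strip≡[]⇒Def0 v strip≡[]) def
vectorsWith-complete (suc f) y (suc m) k {_} (s≤s m≤f) (spec (cons {v} st) z≡ n≡ def) = body (strip v) refl (strip-Dyck st)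
  where
  -- `strip v` is replaced by a variable `w`, so that its Dyck proof can be matched.
  body : ∀ w → w ≡ strip v → Dyck w → (0 ∷ v) ∈ vectorsWith (suc f) y (suc m) k
  body _ w≡ empty = contradiction (trans (cong length w≡) n≡) λ ()
  body _ w≡ (cons {w} st′) with Dyck⇒Def (suc (length w)) ≤-refl (cons st′)
  ... | k′ , def′ =
    concatMap-∈⁺ (λ (j , r) → vectorBlock f y k j r) {diag m} (subst (λ m → (j , r) ∈ diag m) j+r≡m (∈-diag⁺ j r))
      (concatMap-∈⁺ (λ (σ , k′) → map (merge (false ∷ σ)) (vectorsWith f j r k′)) {concatMap (words (suc j) y) (sub (y * r) k)}
        (concatMap-∈⁺ (words (suc j) y) {sub (y * r) k}
          (subst (λ k → inv01 (shape v) + k′ ∈ sub (y * r) k) k≡ (∈-sub⁺ (y * r) (inv01 (shape v) + k′)))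
          (subst₂ (λ o z → (shape v , k′) ∈ words o z (inv01 (shape v) + k′)) (trans (ones-shape v) (cong (cnt 0) (sym w≡)))
            (trans (zeros-shape v) y≡) (∈-words⁺ (shape v) k′)))
        (subst (_∈ map (merge (false ∷ shape v)) (vectorsWith f j r k′)) (trans (cong (λ w → merge (false ∷ shape v) w) w≡) (merge-shape-strip {0} (z≤n ∷ st)))
          (∈-map⁺ (merge (false ∷ shape v)) (vectorsWith-complete f j r k′ (≤-trans (m+n≤o⇒n≤o j (≤-reflexive j+r≡m)) m≤f) (spec (cons st′) refl refl def′)))))
    where
    j = cnt 0 w
    r = length (strip w)
    y≡ : cnt 0 v ≡ y
    y≡ = suc-injective z≡
    j+r≡m : j + r ≡ m
    j+r≡m = suc-injective (trans (cong suc (sym (length-strip w))) (trans (cong length w≡) n≡))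
    k≡ : y * r + (inv01 (shape v) + k′) ≡ k
    k≡ = Def-unique (0 ∷ v) (subst (λ l → Def l (0 ∷ v)) (cong₂ (λ a w → a * length (strip w) + (inv01 (shape v) + k′)) y≡ (sym w≡))
           (Def-strip v k′ (subst (Def k′) w≡ def′))) def

record VectorBlock (f y k j r : ℕ) (v : List ℕ) : Set where
  field
    σ       : List Bool
    k′      : ℕ
    w       : List ℕ
    ones≡   : ones σ ≡ suc j
    zeros≡  : zeros σ ≡ y
    total   : y * r + (inv01 σ + k′) ≡ k
    w∈      : w ∈ vectorsWith f j r k′
    v≡      : v ≡ merge (false ∷ σ) w

∈-words-sub⁻ : ∀ j y c k {σ k′} → (σ , k′) ∈ concatMap (words j y) (sub c k) →
  ones σ ≡ j × zeros σ ≡ y × c + (inv01 σ + k′) ≡ k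
∈-words-sub⁻ j y c k p with concatMap-∈⁻ (words j y) {sub c k} p
... | d , d∈ , q with ∈-words⁻ j y d q
...   | o , z , refl = o , z , ∈-sub⁻ c k d∈

∈-vectorBlock⁻ : ∀ f y k j r {v} → v ∈ vectorBlock f y k j r → VectorBlock f y k j r v
∈-vectorBlock⁻ f y k j r v∈ with concatMap-∈⁻ (λ (σ , k′) → map (merge (false ∷ σ)) (vectorsWith f j r k′)) {concatMap (words (suc j) y) (sub (y * r) k)} v∈
... | (σ , k′) , p , q with ∈-words-sub⁻ (suc j) y (y * r) k p | ∈-map⁻ (merge (false ∷ σ)) q
...   | o , z , t | w , w∈ , v≡ = record { σ = σ ; k′ = k′ ; w = w ; ones≡ = o ; zeros≡ = z ; total = t ; w∈ = w∈ ; v≡ = v≡ }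

replicate-Spec : ∀ y → Spec y 0 0 (replicate (suc y) 0)
replicate-Spec y = spec (cons (steps y)) (cong suc (cnt≡ y)) (cong length (strip≡ y)) (strip≡[]⇒Def0 (replicate y 0) (strip≡ y))
  where
  steps : ∀ y → Steps 0 (replicate y 0)
  steps zero    = []
  steps (suc y) = z≤n ∷ steps y
  cnt≡ : ∀ y → cnt 0 (replicate y 0) ≡ y
  cnt≡ zero    = refl
  cnt≡ (suc y) = cong suc (cnt≡ y)
  strip≡ : ∀ y → strip (replicate y 0) ≡ []
  strip≡ zero    = refl
  strip≡ (suc y) = strip≡ y

vectorsWith-sound : ∀ f y m k {v} → v ∈ vectorsWith f y m k → Spec y m k v
vectorBlock-sound : ∀ f y m k j r {v} → j + r ≡ m → v ∈ vectorBlock f y k j r → Spec y (suc m) k v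
vectorsWith-sound f       y zero    zero (here refl) = replicate-Spec y
vectorsWith-sound (suc f) y (suc m) k v∈ with concatMap-∈⁻ (λ (j , r) → vectorBlock f y k j r) {diag m} v∈
... | (j , r) , jr∈ , p = vectorBlock-sound f y m k j r (∈-diag⁻ m jr∈) p
vectorBlock-sound f y m k j r j+r≡m p with ∈-vectorBlock⁻ f y k j r p
... | record { σ = σ ; k′ = k′ ; w = w ; ones≡ = o ; zeros≡ = z ; total = t ; w∈ = w∈ ; v≡ = refl } with vectorsWith-sound f j r k′ w∈
...   | spec dyck zw nw defw = subst (Spec y (suc m) k) (sym (merge-false-Dyck σ dyck))
        (spec (cons (merge-Dyck σ dyck)) (cong suc cnt≡) (trans (cong length strip≡) (trans (length-strip w) (trans (cong₂ _+_ zw nw) (cong suc j+r≡m)))) def)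
  where
  v = merge σ w
  strip≡ : strip v ≡ w
  strip≡ = strip-merge σ w (trans o (sym zw))
  shape≡ : shape v ≡ σ
  shape≡ = shape-merge σ w (trans o (sym zw))
  cnt≡ : cnt 0 v ≡ y
  cnt≡ = trans (sym (zeros-shape v)) (trans (cong zeros shape≡) z)
  def : Def k (0 ∷ v)
  def = subst (λ l → Def l (0 ∷ v)) (trans (cong₂ _+_ (cong₂ _*_ cnt≡ (trans (cong (length ∘ strip) strip≡) nw)) (cong (λ τ → inv01 τ + k′) shape≡)) t)
          (Def-strip v k′ (subst (Def k′) (sym strip≡) defw))

vectorBlock-strip : ∀ f j r {σ k′ w} → ones σ ≡ suc j → w ∈ vectorsWith f j r k′ →
  strip (merge (false ∷ σ) w) ≡ w × shape (merge (false ∷ σ) w) ≡ false ∷ σ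
vectorBlock-strip f j r {σ} {k′} {w} o w∈ = strip-merge (false ∷ σ) w eq , shape-merge (false ∷ σ) w eq
  where eq = trans o (sym (Spec.zeros≡ (vectorsWith-sound f j r k′ w∈)))

-- Every choice of the recursion can be read off v: `suc j` counts the zeros of `strip v`, `σ` comes
-- from `shape v`, `k′` from the total deficit, and `w` is `strip v`.
unique-vectorsWith : ∀ f y m k → Unique (vectorsWith f y m k)
unique-vectorsWith f       y zero    zero    = [] ∷ []
unique-vectorsWith f       y zero    (suc k) = []
unique-vectorsWith zero    y (suc m) k       = []
unique-vectorsWith (suc f) y (suc m) k       = unique-concatMap (λ (j , r) → vectorBlock f y k j r) (unique-diag m)
  (λ {(j , r)} _ → unique-block j r) (λ {(j , r)} {(j′ , r′)} {v} p q v∈ v∈′ → separated j r j′ r′ p q v∈ v∈′)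
  where
  ones-strip : ∀ j r {v} → v ∈ vectorBlock f y k j r → cnt 0 (strip v) ≡ suc j
  ones-strip j r v∈ with ∈-vectorBlock⁻ f y k j r v∈
  ... | record { σ = σ ; k′ = k′ ; w = w ; ones≡ = o ; w∈ = w∈ ; v≡ = refl } =
    trans (cong (cnt 0) (proj₁ (vectorBlock-strip f j r o w∈))) (Spec.zeros≡ (vectorsWith-sound f j r k′ w∈))
  separated : ∀ j r j′ r′ {v} → (j , r) ∈ diag m → (j′ , r′) ∈ diag m → v ∈ vectorBlock f y k j r → v ∈ vectorBlock f y k j′ r′ → (j , r) ≡ (j′ , r′)
  separated j r j′ r′ p q v∈ v∈′ with suc-injective (trans (sym (ones-strip j r v∈)) (ones-strip j′ r′ v∈′))
  ... | refl = cong (j ,_) (+-cancelˡ-≡ j r r′ (trans (∈-diag⁻ m p) (sym (∈-diag⁻ m q))))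
  unique-block : ∀ j r → Unique (vectorBlock f y k j r)
  unique-block j r = unique-concatMap (λ (σ , k′) → map (merge (false ∷ σ)) (vectorsWith f j r k′))
    (unique-concatMap (words (suc j) y) (unique-sub (y * r) k) (λ {c} _ → unique-words (suc j) y c)
      λ c∈ d∈ _ _ → +-cancelˡ-≡ (y * r) _ _ (trans (∈-sub⁻ (y * r) k c∈) (sym (∈-sub⁻ (y * r) k d∈))))
    (λ {(σ , k′)} s∈ → unique-map (merge (false ∷ σ)) (unique-vectorsWith f j r k′) λ w∈ w′∈ eq →
      let o = proj₁ (∈-words-sub⁻ (suc j) y (y * r) k s∈) in
      trans (sym (proj₁ (vectorBlock-strip f j r o w∈))) (trans (cong strip eq) (proj₁ (vectorBlock-strip f j r o w′∈))))
    λ {(σ , k′)} {(σ′ , k″)} s∈ s′∈ v∈ v∈′ → same-word σ k′ σ′ k″ s∈ s′∈ v∈ v∈′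
    where
    same-word : ∀ σ k′ σ′ k″ {v} → (σ , k′) ∈ concatMap (words (suc j) y) (sub (y * r) k) → (σ′ , k″) ∈ concatMap (words (suc j) y) (sub (y * r) k) →
      v ∈ map (merge (false ∷ σ)) (vectorsWith f j r k′) → v ∈ map (merge (false ∷ σ′)) (vectorsWith f j r k″) → (σ , k′) ≡ (σ′ , k″)
    same-word σ k′ σ′ k″ s∈ s′∈ v∈ v∈′ with ∈-words-sub⁻ (suc j) y (y * r) k s∈ | ∈-words-sub⁻ (suc j) y (y * r) k s′∈
                                            | ∈-map⁻ (merge (false ∷ σ)) v∈ | ∈-map⁻ (merge (false ∷ σ′)) v∈′
    ... | o , _ , t | o′ , _ , t′ | w , w∈ , refl | w′ , w′∈ , eq
      with trans (sym (proj₂ (vectorBlock-strip f j r o w∈))) (trans (cong shape eq) (proj₂ (vectorBlock-strip f j r o′ w′∈)))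
    ...   | refl = cong (σ ,_) (+-cancelˡ-≡ (inv01 σ) k′ k″ (+-cancelˡ-≡ (y * r) _ _ (trans t (sym t′))))

area-vectorsWith : ∀ f y m k → map area (vectorsWith f y m k) ≡ areasWith f y m k
area-vectorBlock : ∀ f y m k j r → j + r ≡ m → map area (vectorBlock f y k j r) ≡ areaBlock f y m k j r
area-vectorsWith f y zero zero    = cong [_] (sum-zeros (suc y))
  where
  sum-zeros : ∀ y → area (replicate y 0) ≡ 0
  sum-zeros zero    = refl
  sum-zeros (suc y) = sum-zeros y
area-vectorsWith f       y zero    (suc k) = refl
area-vectorsWith zero    y (suc m) k       = refl
area-vectorsWith (suc f) y (suc m) k       = trans (map-concatMap area (λ (j , r) → vectorBlock f y k j r) (diag m))
  (concatMap-cong-∈ (diag m) λ {(j , r)} jr∈ → area-vectorBlock f y m k j r (∈-diag⁻ m jr∈))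
area-vectorBlock f y m k j r j+r≡m = begin
  map area (vectorBlock f y k j r)
    ≡⟨ map-concatMap area _ wordsₖ ⟩
  concatMap (λ (σ , k′) → map area (map (merge (false ∷ σ)) (vectorsWith f j r k′))) wordsₖ
    ≡⟨ concatMap-cong-∈ wordsₖ (λ {(σ , k′)} s∈ → trans (sym (map-∘ (vectorsWith f j r k′)))
         (trans (map-cong-local (All.tabulate λ {w} w∈ → area-merge s∈ w∈)) (map-∘ (vectorsWith f j r k′)))) ⟩
  concatMap (λ (σ , k′) → map (suc m +_) (map area (vectorsWith f j r k′))) wordsₖ
    ≡⟨ concatMap-cong (λ (σ , k′) → cong (map (suc m +_)) (area-vectorsWith f j r k′)) wordsₖ ⟩
  concatMap (λ (σ , k′) → map (suc m +_) (areasWith f j r k′)) wordsₖ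
    ≡⟨ concatMap-map (λ k′ → map (suc m +_) (areasWith f j r k′)) proj₂ wordsₖ ⟨
  concatMap (λ k′ → map (suc m +_) (areasWith f j r k′)) (map proj₂ wordsₖ)
    ≡⟨ cong (concatMap _) (trans (map-concatMap proj₂ (words (suc j) y) (sub (y * r) k)) (concatMap-cong (remainders-words (suc j) y) (sub (y * r) k))) ⟩
  areaBlock f y m k j r ∎
  where
  open ≡-Reasoning
  wordsₖ = concatMap (words (suc j) y) (sub (y * r) k)
  area-merge : ∀ {σ k′ w} → (σ , k′) ∈ wordsₖ → w ∈ vectorsWith f j r k′ → area (merge (false ∷ σ) w) ≡ suc m + area w
  area-merge {σ} {k′} {w} s∈ w∈ with vectorBlock-strip f j r (proj₁ (∈-words-sub⁻ (suc j) y (y * r) k s∈)) w∈ | vectorsWith-sound f j r k′ w∈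
  ... | strip≡ , _ | spec _ zw nw _ = trans (area-strip (merge (false ∷ σ) w)) (trans (cong (λ u → length u + area u) strip≡)
    (cong (_+ area w) (trans (length-strip w) (trans (cong₂ _+_ zw nw) (cong suc j+r≡m)))))

-- Comparison with catCoeff

C2≡tri : ∀ n → n C 2 ≡ tri n
C2≡tri zero    = refl
C2≡tri (suc n) = trans (sym (nCk+nC[k+1]≡[n+1]C[k+1] n 1)) (cong₂ _+_ (nC1≡n n) (C2≡tri n))

Steps⇒stepOK : ∀ {x v} → Steps x v → T (stepOK (x ∷ v))
Steps⇒stepOK []                = _
Steps⇒stepOK {x} (_∷_ {z = z} z≤ st) = Equivalence.from T-∧ (fromWitness {a? = z ≤? suc x} z≤ , Steps⇒stepOK st)

stepOK⇒Steps : ∀ x v → T (stepOK (x ∷ v)) → Steps x v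
stepOK⇒Steps x []      _  = []
stepOK⇒Steps x (z ∷ v) ok with Equivalence.to T-∧ ok
... | z≤ , ok′ = toWitness {a? = z ≤? suc x} z≤ ∷ stepOK⇒Steps z v ok′

Dyck⇒isDyck : ∀ {v} → Dyck v → T (isDyck v)
Dyck⇒isDyck empty     = _
Dyck⇒isDyck (cons st) = Steps⇒stepOK st

isDyck⇒Dyck : ∀ v → T (isDyck v) → Dyck v
isDyck⇒Dyck []      _  = empty
isDyck⇒Dyck (x ∷ v) ok with Equivalence.to T-∧ ok
... | x≡0 , ok′ with refl ← toWitness {a? = x ≟ 0} x≡0 = cons (stepOK⇒Steps 0 v ok′)

∈-allVecs⁺ : ∀ m {v} → All (_< m) v → v ∈ allVecs m (length v)
∈-allVecs⁺ m []         = here refl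
∈-allVecs⁺ m {_ ∷ v} (x< ∷ v<) = concatMap-∈⁺ (λ x → map (x ∷_) (allVecs m (length v))) (∈-upTo⁺ x<) (∈-map⁺ _ (∈-allVecs⁺ m v<))

∈-allVecs⁻ : ∀ m n {v} → v ∈ allVecs m n → length v ≡ n
∈-allVecs⁻ m zero    (here refl) = refl
∈-allVecs⁻ m (suc n) v∈ with concatMap-∈⁻ (λ x → map (x ∷_) (allVecs m n)) {upTo m} v∈
... | x , _ , p with ∈-map⁻ (x ∷_) p
...   | u , u∈ , refl = cong suc (∈-allVecs⁻ m n u∈)

unique-allVecs : ∀ m n → Unique (allVecs m n)
unique-allVecs m zero    = [] ∷ []
unique-allVecs m (suc n) = unique-concatMap (λ x → map (x ∷_) (allVecs m n)) (Unique.upTo⁺ m)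
  (λ _ → Unique.map⁺ (λ where refl → refl) (unique-allVecs m n)) same-head
  where
  same-head : ∀ {x z v} → x ∈ upTo m → z ∈ upTo m → v ∈ map (x ∷_) (allVecs m n) → v ∈ map (z ∷_) (allVecs m n) → x ≡ z
  same-head {x} {z} _ _ p q with ∈-map⁻ (x ∷_) p | ∈-map⁻ (z ∷_) q
  ... | _ , _ , refl | _ , _ , refl = refl

Steps⇒bounded : ∀ {x v} n → Steps x v → suc x + length v ≤ n → All (_< n) v
Steps⇒bounded n []               _  = []
Steps⇒bounded {x} n (_∷_ {z = z} {v} z≤ st) le =
  ≤-trans (≤-trans (s≤s z≤) (s≤s (s≤s (m≤m+n x (length v))))) le′ ∷
  Steps⇒bounded n st (≤-trans (s≤s (+-monoˡ-≤ (length v) z≤)) le′)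
  where
  le′ : suc (suc x) + length v ≤ n
  le′ = ≤-trans (≤-reflexive (cong suc (sym (+-suc x (length v))))) le

Dyck⇒∈allVecs : ∀ {v} → Dyck v → v ∈ allVecs (length v) (length v)
Dyck⇒∈allVecs empty         = here refl
Dyck⇒∈allVecs (cons {v} st) = ∈-allVecs⁺ (suc (length v)) (s≤s z≤n ∷ Steps⇒bounded (suc (length v)) st ≤-refl)

unique-set⇒length : {X : Set} {xs ys : List X} → Unique xs → Unique ys → (∀ {x} → x ∈ xs → x ∈ ys) → (∀ {x} → x ∈ ys → x ∈ xs) → length xs ≡ length ys
unique-set⇒length uxs uys to from = ↭-length (∼bag⇒↭ (unique∧set⇒bag uxs uys (mk⇔ to from)))

vectors : ℕ → ℕ → List (List ℕ)
vectors p k = concatMap (λ (y , m) → vectorsWith p y m k) (diag p)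

∈-vectors⁺ : ∀ p k {v} → Dyck v → length v ≡ suc p → Def k v → v ∈ vectors p k
∈-vectors⁺ p k (cons {v} st) len def =
  concatMap-∈⁺ (λ (y , m) → vectorsWith p y m k) {diag p}
    (subst (λ p → (cnt 0 v , length (strip v)) ∈ diag p) y+m≡p (∈-diag⁺ (cnt 0 v) (length (strip v))))
    (vectorsWith-complete p _ _ k (m+n≤o⇒n≤o (cnt 0 v) (≤-reflexive y+m≡p)) (spec (cons st) refl refl def))
  where
  y+m≡p : cnt 0 v + length (strip v) ≡ p
  y+m≡p = trans (sym (length-strip v)) (suc-injective len)

∈-vectors⁻ : ∀ p k {v} → v ∈ vectors p k → Dyck v × length v ≡ suc p × Def k v
∈-vectors⁻ p k {v} v∈ with concatMap-∈⁻ (λ (y , m) → vectorsWith p y m k) {diag p} v∈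
... | (y , m) , ym∈ , p∈ with vectorsWith-sound p y m k p∈
...   | spec dyck z n def = dyck , trans (length-strip v) (trans (cong₂ _+_ z n) (cong suc (∈-diag⁻ p ym∈))) , def

unique-vectors : ∀ p k → Unique (vectors p k)
unique-vectors p k = unique-concatMap (λ (y , m) → vectorsWith p y m k) (unique-diag p) (λ {(y , m)} _ → unique-vectorsWith p y m k)
  λ {(y , m)} {(y′ , m′)} _ _ v∈ v∈′ → same (vectorsWith-sound p y m k v∈) (vectorsWith-sound p y′ m′ k v∈′)
  where
  same : ∀ {y m y′ m′ v} → Spec y m k v → Spec y′ m′ k v → (y , m) ≡ (y′ , m′)
  same s s′ = cong₂ _,_ (suc-injective (trans (sym (Spec.zeros≡ s)) (Spec.zeros≡ s′))) (trans (sym (Spec.nonzeros≡ s)) (Spec.nonzeros≡ s′))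

area-vectors : ∀ p k → map area (vectors p k) ≡ areas p k
area-vectors p k = trans (map-concatMap area (λ (y , m) → vectorsWith p y m k) (diag p)) (concatMap-cong (λ (y , m) → area-vectorsWith p y m k) (diag p))

length-filter-area : ∀ a vs → length (filterᵇ (λ v → area v ≡ᵇ a) vs) ≡ cnt a (map area vs)
length-filter-area a []       = refl
length-filter-area a (v ∷ vs) with area v ≡ᵇ a
... | true  = cong suc (length-filter-area a vs)
... | false = length-filter-area a vs

selected : ℕ → ℕ → ℕ → List ℕ → Bool
selected k a b v = hasDef k v ∧ ⌊ area v ≟ a ⌋ ∧ ⌊ dinv v ≟ b ⌋

selected⁻ : ∀ k a b v → T (selected k a b v) → Def k v × area v ≡ a × dinv v ≡ b
selected⁻ k a b v t with Equivalence.to T-∧ t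
... | d , t′ with Equivalence.to T-∧ t′
...   | p , q = trans (sym (C2≡tri (length v))) (toWitness {a? = length v C 2 ≟ area v + dinv v + k} d)
              , toWitness {a? = area v ≟ a} p , toWitness {a? = dinv v ≟ b} q

selected⁺ : ∀ k a b v → Def k v → area v ≡ a → dinv v ≡ b → T (selected k a b v)
selected⁺ k a b v d p q = Equivalence.from T-∧
  (fromWitness {a? = length v C 2 ≟ area v + dinv v + k} (trans (C2≡tri (length v)) d)
  , Equivalence.from T-∧ (fromWitness {a? = area v ≟ a} p , fromWitness {a? = dinv v ≟ b} q))

∈-selected⁻ : ∀ n k a b {v} → v ∈ filterᵇ (selected k a b) (DV n) →
  Dyck v × length v ≡ n × Def k v × area v ≡ a × dinv v ≡ b
∈-selected⁻ n k a b {v} v∈ with ∈-filter⁻ (T? ∘ selected k a b) {xs = DV n} v∈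
... | v∈DV , sel with ∈-filter⁻ (T? ∘ isDyck) {xs = allVecs n n} v∈DV
...   | v∈all , dyck = isDyck⇒Dyck v dyck , ∈-allVecs⁻ n n v∈all , selected⁻ k a b v sel

-- Given deficit `k` and area `a`, the hypothesis `total` forces dinv to be `b`. Both lists are free
-- of repetitions and have the same members.
catCoeff-areas : ∀ p k a b → a + b + k ≡ tri (suc p) → catCoeff (suc p) k a b ≡ cnt a (areas p k)
catCoeff-areas p k a b total = begin
  catCoeff (suc p) k a b
    ≡⟨ unique-set⇒length
         (Unique.filter⁺ (T? ∘ selected k a b) (Unique.filter⁺ (T? ∘ isDyck) (unique-allVecs (suc p) (suc p))))
         (Unique.filter⁺ (T? ∘ λ v → area v ≡ᵇ a) (unique-vectors p k)) to from ⟩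
  length (filterᵇ (λ v → area v ≡ᵇ a) (vectors p k))
    ≡⟨ length-filter-area a (vectors p k) ⟩
  cnt a (map area (vectors p k))
    ≡⟨ cong (cnt a) (area-vectors p k) ⟩
  cnt a (areas p k) ∎
  where
  open ≡-Reasoning
  to : ∀ {v} → v ∈ filterᵇ (selected k a b) (DV (suc p)) → v ∈ filterᵇ (λ v → area v ≡ᵇ a) (vectors p k)
  to {v} v∈ with ∈-selected⁻ (suc p) k a b v∈
  ... | dyck , len , def , area≡ , _ = ∈-filter⁺ (T? ∘ λ v → area v ≡ᵇ a) (∈-vectors⁺ p k dyck len def) (≡⇒≡ᵇ (area v) a area≡)
  from : ∀ {v} → v ∈ filterᵇ (λ v → area v ≡ᵇ a) (vectors p k) → v ∈ filterᵇ (selected k a b) (DV (suc p))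
  from {v} v∈ with ∈-filter⁻ (T? ∘ λ v → area v ≡ᵇ a) {xs = vectors p k} v∈
  ... | v∈′ , area≡ with ∈-vectors⁻ p k v∈′ | ≡ᵇ⇒≡ (area v) a area≡
  ...   | dyck , len , def | refl = ∈-filter⁺ (T? ∘ selected k a b)
    (∈-filter⁺ (T? ∘ isDyck) (subst (λ n → v ∈ allVecs n n) len (Dyck⇒∈allVecs dyck)) (Dyck⇒isDyck dyck))
    (selected⁺ k a b v def refl dinv≡b)
    where
    dinv≡b : dinv v ≡ b
    dinv≡b = +-cancelˡ-≡ a _ _ (+-cancelʳ-≡ k _ _ (trans (sym def) (trans (cong tri len) (sym total))))

catCoeff-zero : ∀ n k a b → a + b + k ≢ tri n → catCoeff n k a b ≡ 0
catCoeff-zero n k a b total≢ = cong length (empty-list (λ {v} v∈ → excluded v (∈-selected⁻ n k a b v∈)))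
  where
  excluded : ∀ v → ¬ (Dyck v × length v ≡ n × Def k v × area v ≡ a × dinv v ≡ b)
  excluded v (_ , refl , def , refl , refl) = total≢ (sym def)
  empty-list : ∀ {vs : List (List ℕ)} → (∀ {v} → ¬ (v ∈ vs)) → vs ≡ []
  empty-list {[]}     _  = refl
  empty-list {v ∷ vs} ∉ = contradiction (here refl) ∉

theorem1p6 : (n k : ℕ) → k ≤ 9 → (a b : ℕ) → catCoeff n k a b ≡ catCoeff n k b a
theorem1p6 n k k≤9 a b with a + b + k ≟ tri n
... | no ≢tri = trans (catCoeff-zero n k a b ≢tri) (sym (catCoeff-zero n k b a (≢tri ∘ trans (cong (_+ k) (+-comm a b)))))
-- For length 0 the total is 0, so only `a = b = 0` can occur.
theorem1p6 zero    k k≤9 zero zero | yes _ = refl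
theorem1p6 (suc p) k k≤9 a    b    | yes total = begin
  catCoeff (suc p) k a b   ≡⟨ catCoeff-areas p k a b total ⟩
  cnt a (areas p k)        ≡⟨ symmetric-areas k≤9 p a b total ⟩
  cnt b (areas p k)        ≡⟨ catCoeff-areas p k b a (trans (cong (_+ k) (+-comm b a)) total) ⟨
  catCoeff (suc p) k b a   ∎
  where open ≡-Reasoning
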